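{- Let $a_1,\dots,a_d$ be pairwise relatively prime positive integers and let $n\in\mathbb{Z}$. Suppose one of the following holds: (i) $1-\min\{a_1,\dots,a_d\}\le n\le -1$; (ii) $1\le n\le a_1+\cdots+a_d-1$; (iii) $a_1+\cdots+a_d+1\le n\le a_1+\cdots+a_d+\min\{a_1,\dots,a_d\}-1$. Then \[S_{(a_2,\dots,a_d;a_1)}(n)+S_{(a_1,a_3,\dots,a_d;a_2)}(n)+\cdots+S_{(a_1,\dots,a_{d-1};a_d)}(n)=-\mathrm{poly}_{\{a_1,\dots,a_d\}}(-n).\]
   Context: For an integer $b\ge1$, $\xi_b=e^{2\pi i/b}$ and positive integers $c_1,\dots,c_k$ coprime to $b$, $S_{(c_1,\dots,c_k;b)}(n)=\frac1b\sum_{j=1}^{b-1}\frac{\xi_b^{jn}}{(1-\xi_b^{jc_1})\cdots(1-\xi_b^{jc_k})}$ (an empty sum, i.e. $0$, when $b=1$; the denominator is $1$ when $k=0$). The $m$th summand on the left omits $a_m$ from the list and uses modulus $a_m$. The polynomial $\mathrm{poly}_{\{a_1,\dots,a_d\}}(t)$ is the polynomial part of the restricted partition function $p_{\{a_1,\dots,a_d\}}(n)=\#\{(m_1,\dots,m_d)\in\mathbb{Z}_{\ge0}^d:m_1a_1+\cdots+m_da_d=n\}$, explicitly \[\mathrm{poly}_{\{a_1,\dots,a_d\}}(t)=\frac{1}{a_1\cdots a_d}\sum_{m=0}^{d-1}\frac{(-1)^m}{(d-1-m)!}\sum_{k_1+\cdots+k_d=m}a_1^{k_1}\cdots a_d^{k_d}\frac{B_{k_1}\cdots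 B_{k_d}}{k_1!\cdots k_d!}t^{d-1-m},\] with $k_i\ge0$ and $B_j$ the Bernoulli numbers ($B_1=-\tfrac12$). -}

module Defs where

open import Level using (Level; _⊔_) renaming (suc to lsuc)
open import Algebra.Bundles using (CommutativeRing)
open import Data.Nat as ℕ using (ℕ; zero; suc; _∸_; _⊓_)
open import Data.Nat.Properties using (_!≢0)
open import Data.Nat.Combinatorics using (_C_)
open import Data.Integer as ℤ using (ℤ; +_; -[1+_])
open import Data.Rational as ℚ using (ℚ; _/_)
open import Data.Fin using (Fin; zero; suc)
import Data.Fin
open import Data.Vec.Functional using (removeAt)
open import Relation.Nullary using (¬_)

natR : ∀ {c ℓ} (R : CommutativeRing c ℓ) → ℕ → CommutativeRing.Carrier R
natR R zero    = CommutativeRing.0# R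
natR R (suc n) = CommutativeRing._+_ R (CommutativeRing.1# R) (natR R n)

intR : ∀ {c ℓ} (R : CommutativeRing c ℓ) → ℤ → CommutativeRing.Carrier R
intR R (+ n)     = natR R n
intR R -[1+ n ]  = CommutativeRing.-_ R (natR R (suc n))

record Char0Field c ℓ : Set (lsuc (c ⊔ ℓ)) where
  field
    cring   : CommutativeRing c ℓ
  open CommutativeRing cring public using (Carrier; _≈_; _+_; _*_; -_; _-_; 0#; 1#)
  field
    _⁻¹     : Carrier → Carrier
    inverseʳ : ∀ x → ¬ (x ≈ 0#) → (x * (x ⁻¹)) ≈ 1#
    char0   : ∀ n → ¬ (natR cring (suc n) ≈ 0#)

module _ {c ℓ} (K : Char0Field c ℓ) where
  open Char0Field K using (Carrier; _≈_; _+_; _*_; _-_; 0#; 1#; _⁻¹; cring)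

  pow : Carrier → ℕ → Carrier
  pow x zero    = 1#
  pow x (suc k) = x * pow x k

  zpow : Carrier → ℤ → Carrier
  zpow x (+ k)      = pow x k
  zpow x -[1+ k ]   = (pow x (suc k)) ⁻¹

  IsPrimitiveRoot : ℕ → Carrier → Set ℓ
  IsPrimitiveRoot b ζ = (pow ζ b ≈ 1#) × (∀ k → 1 ℕ.≤ k → k ℕ.< b → ¬ (pow ζ k ≈ 1#))
    where open import Data.Product using (_×_)

  sumFin : (k : ℕ) → (Fin k → Carrier) → Carrier
  sumFin zero    f = 0#
  sumFin (suc k) f = f zero + sumFin k (λ i → f (suc i))

  prodFin : (k : ℕ) → (Fin k → Carrier) → Carrier
  prodFin zero    f = 1#
  prodFin (suc k) f = f zero * prodFin k (λ i → f (suc i))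

  sumFrom1 : ℕ → (ℕ → Carrier) → Carrier
  sumFrom1 b f = go (b ∸ 1)
    where
      go : ℕ → Carrier
      go zero    = 0#
      go (suc j) = go j + f (suc j)

  -- Fourier–Dedekind sum S_{(c_1,…,c_k; b)}(n), computed with a primitive
  -- b-th root of unity ζ in place of ξ_b = e^{2πi/b}:
  --   (1/b) Σ_{j=1}^{b-1} ζ^{jn} / Π_i (1 - ζ^{j c_i})
  S : (k : ℕ) → (Fin k → ℕ) → (b : ℕ) → (ζ : Carrier) → ℤ → Carrier
  S k cs b ζ n =
    (natR cring b) ⁻¹ *
    sumFrom1 b (λ j →
      zpow ζ ((+ j) ℤ.* n) *
      (prodFin k (λ i → 1# - pow ζ (j ℕ.* cs i))) ⁻¹)

  ratK : ℚ → Carrier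
  ratK q = intR cring (ℚ.numerator q) * (natR cring (ℚ.denominatorℕ q)) ⁻¹

sumℚ : ℕ → (ℕ → ℚ) → ℚ
sumℚ zero    f = ℚ.0ℚ
sumℚ (suc n) f = sumℚ n f ℚ.+ f n

powℚ : ℚ → ℕ → ℚ
powℚ x zero    = ℚ.1ℚ
powℚ x (suc k) = x ℚ.* powℚ x k

natℚ : ℕ → ℚ
natℚ n = (+ n) / 1

-- 1/n for n ≥ 1 (junk value 0 at n = 0, never used)
invℕ : ℕ → ℚ
invℕ zero    = ℚ.0ℚ
invℕ (suc n) = (+ 1) / suc n

invFact : ℕ → ℚ
invFact k = _/_ (+ 1) (k ℕ.!) {{k !≢0}}

-- Bernoulli numbers, B_0 = 1, B_m = -1/(m+1) Σ_{k<m} C(m+1,k) B_k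
-- (so B_1 = -1/2).
bernTable : (m : ℕ) → Fin (suc m) → ℚ
bernTable zero    _       = ℚ.1ℚ
bernTable (suc m) (suc i) = bernTable m i
bernTable (suc m) zero    =
  ℚ.- (invℕ (suc (suc m)) ℚ.*
        sumFin' (suc m) (λ k → natℚ (suc (suc m) C Data.Fin.toℕ k) ℚ.* bernTable m (rev k)))
  where
    -- bernTable m stores B_m at index 0, B_{m-1} at index 1, …, B_0 at index m
    rev : Fin (suc m) → Fin (suc m)
    rev k = Data.Fin.opposite k
    sumFin' : (n : ℕ) → (Fin n → ℚ) → ℚ
    sumFin' zero    f = ℚ.0ℚ
    sumFin' (suc n) f = f zero ℚ.+ sumFin' n (λ i → f (suc i))

bernoulli : ℕ → ℚ
bernoulli m = bernTable m zero

compSum : (d : ℕ) → (Fin d → ℕ → ℚ) → ℕ → ℚ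
compSum zero    f zero    = ℚ.1ℚ
compSum zero    f (suc m) = ℚ.0ℚ
compSum (suc d) f m =
  sumℚ (suc m) (λ j → f zero j ℚ.* compSum d (λ i → f (suc i)) (m ∸ j))

prodℕ : (d : ℕ) → (Fin d → ℕ) → ℕ
prodℕ zero    a = 1
prodℕ (suc d) a = a zero ℕ.* prodℕ d (λ i → a (suc i))

sumℕ : (d : ℕ) → (Fin d → ℕ) → ℕ
sumℕ zero    a = 0
sumℕ (suc d) a = a zero ℕ.+ sumℕ d (λ i → a (suc i))

minℕ : (e : ℕ) → (Fin (suc e) → ℕ) → ℕ
minℕ zero    a = a zero
minℕ (suc e) a = a zero ⊓ minℕ e (λ i → a (suc i))

poly : (d : ℕ) → (Fin d → ℕ) → ℚ → ℚ
poly d a t =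
  invℕ (prodℕ d a) ℚ.*
  sumℚ d (λ m →
    powℚ (ℚ.- ℚ.1ℚ) m ℚ.* invFact (d ∸ 1 ∸ m) ℚ.*
    compSum d (λ i k → powℚ (natℚ (a i)) k ℚ.* bernoulli k ℚ.* invFact k) m ℚ.*
    powℚ t (d ∸ 1 ∸ m))

-- For a list L of pairs (a , ζ) put Q_L(n) = Σ S(n) + poly_L(−n); the claim is that Q_L(n) = 0.
-- Adjoining an entry of size a inverts a difference operator:
--   Q_{a∷L}(n) − Q_{a∷L}(n + a) = Q_L(n),
-- for the Fourier–Dedekind sums because ζ^(j(n+a)) = ζ^(jn) ζ^(ja), and for poly because
-- β(ax)(e^(ax) − 1) = ax with β(x) = x/(e^x − 1).
-- Range (ii) goes by induction on the length of L.  By induction Q_L has periods a₁ and a₂ on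
-- (0, Σa), so it is a constant there by the Fine–Wilf theorem.  Summing a consecutive values of
-- Q_{a∷L} and telescoping through Q_{1∷a∷L} shows a · Q_{a∷L}(1) = Q_{1∷L}(1), so only the list
-- of ones matters, for which the constant is, up to sign, the coefficient of x^(d−1) in β^d e^x.
-- That coefficient vanishes since β² e^x = β − x β′.
-- Ranges (i) and (iii) follow from (ii) by one application of the difference equation per entry.

module Submission where

open import Defs
open import Level using (Level)
open import Algebra.Bundles using (CommutativeRing)
import Algebra.Properties.Ring
import Algebra.Properties.Semiring.Mult
import Algebra.Solver.Ring
import Algebra.Solver.Ring.AlmostCommutativeRing as ACR
open import Data.Nat as ℕ using (ℕ; zero; suc; _∸_)
import Data.Nat.Properties as ℕₚ
open import Data.Nat.Combinatorics using (_C_; nCk≡n!/k![n-k]!; nC1≡n; nCk≡nC[n∸k]; k![n∸k]!∣n!; nCn≡1)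
open import Data.Nat.Coprimality as Coprimality using (Coprime; coprime-divisor)
open import Data.Nat.Divisibility using (_∣_; m%n≡0⇒n∣m; ∣⇒≤; ∣-refl; ∣m∣n⇒∣m+n)
import Data.Nat.DivMod as ℕ
open import Data.Nat.ListAction using (product; sum)
open import Data.Nat.ListAction.Properties using (product-↭)
open import Data.Integer as ℤ using (ℤ; +_; -[1+_])
import Data.Integer.Properties as ℤₚ
open import Data.Rational as ℚ using (ℚ; mkℚ; 0ℚ; 1ℚ; _/_)
import Data.Rational.Properties as ℚₚ
import Data.Rational.Unnormalised as ℚᵘ
import Data.Rational.Unnormalised.Properties as ℚᵘₚ
open import Data.Rational.Solver using (module +-*-Solver)
open import Data.Fin using (Fin; zero; suc; toℕ; opposite; punchIn)
import Data.Fin.Properties as Finₚ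
open import Data.List using (List; []; _∷_; _++_; length; map; replicate; tabulate)
open import Data.List.Properties using (length-replicate; length-tabulate; map-replicate; map-tabulate; ++-identityʳ)
open import Data.List.Relation.Unary.All as All using (All; []; _∷_)
import Data.List.Relation.Unary.All.Properties as Allₚ
open import Data.List.Relation.Unary.AllPairs using (AllPairs; []; _∷_)
import Data.List.Relation.Unary.AllPairs.Properties as AllPairsₚ
open import Data.List.Relation.Binary.Permutation.Propositional as Perm using (_↭_; prep; swap)
import Data.List.Relation.Binary.Permutation.Propositional.Properties as Permₚ
import Data.List.Relation.Binary.Permutation.Setoid.Properties as PermSetoidₚ
open import Data.Maybe using (just; nothing)
open import Data.Product using (_×_; _,_; proj₁; proj₂)
open import Data.Sum using (_⊎_; inj₁; inj₂)
open import Data.Vec.Functional using (removeAt)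
open import Relation.Binary using (Setoid)
open import Relation.Binary.Definitions using (WeaklyDecidable)
open import Relation.Binary.PropositionalEquality as ≡ using (_≡_; _≢_)
import Relation.Binary.Reasoning.Setoid
open import Relation.Nullary using (¬_; yes; no; contradiction)

-- The open interval (0, Σa) holds a₁ + a₂ - 1 integers plus the sizes of the remaining entries, so
-- it always reaches the Fine-Wilf bound for coprime periods a₁ and a₂. A period a₁ is available
-- only where Q of the list without a₁ is known to vanish, and range (ii) for that shorter list is
-- just long enough. A single entry has no second period; there the sum is a geometric series.
-- Constancy leaves the value open, and the value at 1 still involves roots of unity. Entries of
-- size 1 are the way out: they are coprime to everything and their own sums are empty, so one can
-- be adjoined to any list without spoiling the hypotheses. Once all sizes are 1, no root of unity
-- is left and the claim concerns Bernoulli numbers alone. Exchanging a for 1 keeps the length of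
-- the list, which matters because constancy is established for one length at a time.

module Series where
  open ≡ using (refl; sym; trans; cong; cong₂)
  open ≡.≡-Reasoning
  open import Data.Rational using (_+_; _*_; -_; _-_)
  open +-*-Solver using (solve; _:=_; _:+_; _:*_; _:-_; :-_; con)

  -- Integers inside the rationals

  toℚᵘ-/ : ∀ i n → ℚ.toℚᵘ (i / suc n) ℚᵘ.≃ ℚᵘ.mkℚᵘ i n
  toℚᵘ-/ i n = ℚₚ.toℚᵘ-fromℚᵘ (ℚᵘ.mkℚᵘ i n)

  /1-homo-+ : ∀ i j → (i ℤ.+ j) / 1 ≡ i / 1 + j / 1
  /1-homo-+ i j = ℚₚ.toℚᵘ-injective (ℚᵘₚ.≃-trans (toℚᵘ-/ (i ℤ.+ j) 0) (ℚᵘₚ.≃-trans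
    (ℚᵘ.*≡* (cong (ℤ._* + 1) (cong₂ ℤ._+_ (sym (ℤₚ.*-identityʳ i)) (sym (ℤₚ.*-identityʳ j)))))
    (ℚᵘₚ.≃-sym (ℚᵘₚ.≃-trans (ℚₚ.toℚᵘ-homo-+ (i / 1) (j / 1)) (ℚᵘₚ.+-cong (toℚᵘ-/ i 0) (toℚᵘ-/ j 0))))))

  /1-homo-* : ∀ i j → (i ℤ.* j) / 1 ≡ i / 1 * (j / 1)
  /1-homo-* i j = ℚₚ.toℚᵘ-injective (ℚᵘₚ.≃-trans (toℚᵘ-/ (i ℤ.* j) 0) (ℚᵘₚ.≃-sym
    (ℚᵘₚ.≃-trans (ℚₚ.toℚᵘ-homo-* (i / 1) (j / 1)) (ℚᵘₚ.*-cong (toℚᵘ-/ i 0) (toℚᵘ-/ j 0)))))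

  natℚ-suc : ∀ n → natℚ (suc n) ≡ 1ℚ + natℚ n
  natℚ-suc n = /1-homo-+ (+ 1) (+ n)

  natℚ-* : ∀ m n → natℚ (m ℕ.* n) ≡ natℚ m * natℚ n
  natℚ-* m n = trans (cong (_/ 1) (ℤₚ.pos-* m n)) (/1-homo-* (+ m) (+ n))

  natℚ*1/n : ∀ n .{{_ : ℕ.NonZero n}} → natℚ n * (+ 1 / n) ≡ 1ℚ
  natℚ*1/n (suc n) = ℚₚ.toℚᵘ-injective
    (ℚᵘₚ.≃-trans (ℚₚ.toℚᵘ-homo-* (natℚ (suc n)) (+ 1 / suc n))
    (ℚᵘₚ.≃-trans (ℚᵘₚ.*-cong (toℚᵘ-/ (+ suc n) 0) (toℚᵘ-/ (+ 1) n))
    (ℚᵘ.*≡* (cong +_ (trans (ℕₚ.*-identityʳ _) (trans (ℕₚ.*-identityʳ _) (sym (trans (ℕₚ.*-identityˡ _) (ℕₚ.*-identityˡ _)))))))))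

  -- Formal power series over the rationals

  Series : Set
  Series = ℕ → ℚ

  infix 4 _≐_
  _≐_ : Series → Series → Set
  f ≐ g = ∀ k → f k ≡ g k

  infixl 7 _⊛_
  -- The Cauchy product, by recursion on f = f 0 + x f′, so that its laws follow by induction on the
  -- degree without manipulating finite sums.
  _⊛_ : Series → Series → Series
  (f ⊛ g) zero    = f 0 * g 0
  (f ⊛ g) (suc k) = f 0 * g (suc k) + ((λ j → f (suc j)) ⊛ g) k

  infixl 6 _⊕_
  _⊕_ : Series → Series → Series
  (f ⊕ g) k = f k + g k

  _·_ : ℚ → Series → Series
  (c · f) k = c * f k

  one : Series
  one zero    = 1ℚ
  one (suc k) = 0ℚ

  shift : Series → Series
  shift f zero    = 0ℚ
  shift f (suc k) = f k

  -- The operator x d/dx: a derivation like d/dx, but one that keeps degrees.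
  θ : Series → Series
  θ f k = natℚ k * f k

  -- The substitution of c x for x.
  scale : ℚ → Series → Series
  scale c f k = powℚ c k * f k

  ⊛-cong : ∀ {f f′ g g′} → f ≐ f′ → g ≐ g′ → f ⊛ g ≐ f′ ⊛ g′
  ⊛-cong p q zero    = cong₂ _*_ (p 0) (q 0)
  ⊛-cong p q (suc k) = cong₂ _+_ (cong₂ _*_ (p 0) (q (suc k))) (⊛-cong (λ j → p (suc j)) q k)

  ⊛-congˡ : ∀ f {g g′} → g ≐ g′ → f ⊛ g ≐ f ⊛ g′
  ⊛-congˡ f q = ⊛-cong (λ _ → refl) q

  ⊛-congʳ : ∀ g {f f′} → f ≐ f′ → f ⊛ g ≐ f′ ⊛ g
  ⊛-congʳ g p = ⊛-cong p (λ _ → refl)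

  ⊛-distribʳ : ∀ f f′ g → (f ⊕ f′) ⊛ g ≐ f ⊛ g ⊕ f′ ⊛ g
  ⊛-distribʳ f f′ g zero    = ℚₚ.*-distribʳ-+ (g 0) (f 0) (f′ 0)
  ⊛-distribʳ f f′ g (suc k) = trans
    (cong (λ z → ((f 0 + f′ 0) * g (suc k)) + z) (⊛-distribʳ (λ j → f (suc j)) (λ j → f′ (suc j)) g k))
    (solve 5 (λ a b c x y → (a :+ b) :* c :+ (x :+ y) := (a :* c :+ x) :+ (b :* c :+ y)) refl
      (f 0) (f′ 0) (g (suc k)) _ _)

  ·-⊛ : ∀ c f g → (c · f) ⊛ g ≐ c · (f ⊛ g)
  ·-⊛ c f g zero    = ℚₚ.*-assoc c (f 0) (g 0)
  ·-⊛ c f g (suc k) = trans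
    (cong (λ z → (c * f 0 * g (suc k)) + z) (·-⊛ c (λ j → f (suc j)) g k))
    (solve 4 (λ c a b x → c :* a :* b :+ c :* x := c :* (a :* b :+ x)) refl c (f 0) (g (suc k)) _)

  ⊛-assoc : ∀ f g h → (f ⊛ g) ⊛ h ≐ f ⊛ (g ⊛ h)
  ⊛-assoc f g h zero    = ℚₚ.*-assoc (f 0) (g 0) (h 0)
  ⊛-assoc f g h (suc k) = begin
    f 0 * g 0 * h (suc k) + (((f 0 · (λ j → g (suc j))) ⊕ (f′ ⊛ g)) ⊛ h) k
      ≡⟨ cong (λ z → f 0 * g 0 * h (suc k) + z) (trans (⊛-distribʳ (f 0 · (λ j → g (suc j))) (f′ ⊛ g) h k)
                            (cong₂ _+_ (·-⊛ (f 0) (λ j → g (suc j)) h k) (⊛-assoc f′ g h k))) ⟩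
    f 0 * g 0 * h (suc k) + (f 0 * ((λ j → g (suc j)) ⊛ h) k + (f′ ⊛ (g ⊛ h)) k)
      ≡⟨ solve 5 (λ a b c x y → a :* b :* c :+ (a :* x :+ y) := a :* (b :* c :+ x) :+ y) refl
           (f 0) (g 0) (h (suc k)) _ _ ⟩
    f 0 * (g ⊛ h) (suc k) + (f′ ⊛ (g ⊛ h)) k ∎
    where f′ = λ j → f (suc j)

  -- The definition peels the left factor; commutativity needs this mirror image, which peels the
  -- right one.
  ⊛-sucʳ : ∀ f g k → (f ⊛ g) (suc k) ≡ (f ⊛ (λ j → g (suc j))) k + f (suc k) * g 0
  ⊛-sucʳ f g zero    = refl
  ⊛-sucʳ f g (suc k) = trans (cong (λ z → (f 0 * g (suc (suc k))) + z) (⊛-sucʳ (λ j → f (suc j)) g k))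
    (sym (ℚₚ.+-assoc (f 0 * g (suc (suc k))) _ _))

  ⊛-comm : ∀ f g → f ⊛ g ≐ g ⊛ f
  ⊛-comm f g zero    = ℚₚ.*-comm (f 0) (g 0)
  ⊛-comm f g (suc k) = trans
    (cong₂ _+_ (ℚₚ.*-comm (f 0) (g (suc k))) (⊛-comm (λ j → f (suc j)) g k))
    (trans (ℚₚ.+-comm (g (suc k) * f 0) ((g ⊛ λ j → f (suc j)) k)) (sym (⊛-sucʳ g f k)))

  ⊛-identityˡ : ∀ g → one ⊛ g ≐ g
  ⊛-identityˡ g zero    = ℚₚ.*-identityˡ (g 0)
  ⊛-identityˡ g (suc k) = trans
    (cong₂ _+_ (ℚₚ.*-identityˡ (g (suc k))) (zeros k)) (ℚₚ.+-identityʳ _)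
    where
    zeros : (λ _ → 0ℚ) ⊛ g ≐ (λ _ → 0ℚ)
    zeros zero    = ℚₚ.*-zeroˡ (g 0)
    zeros (suc k) = trans (cong₂ _+_ (ℚₚ.*-zeroˡ (g (suc k))) (zeros k)) refl

  ⊛-distribˡ : ∀ f g h → f ⊛ (g ⊕ h) ≐ f ⊛ g ⊕ f ⊛ h
  ⊛-distribˡ f g h k = trans (⊛-comm f (g ⊕ h) k) (trans (⊛-distribʳ g h f k)
    (cong₂ _+_ (⊛-comm g f k) (⊛-comm h f k)))

  shift-⊛ : ∀ f g → shift f ⊛ g ≐ shift (f ⊛ g)
  shift-⊛ f g zero    = ℚₚ.*-zeroˡ (g 0)
  shift-⊛ f g (suc k) = trans (cong (_+ (f ⊛ g) k) (ℚₚ.*-zeroˡ (g (suc k)))) (ℚₚ.+-identityˡ _)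

  shift-cong : ∀ {f g} → f ≐ g → shift f ≐ shift g
  shift-cong p zero    = refl
  shift-cong p (suc k) = p k

  ⊛-shift : ∀ f g → f ⊛ shift g ≐ shift (f ⊛ g)
  ⊛-shift f g k = trans (⊛-comm f (shift g) k) (trans (shift-⊛ g f k) (shift-cong (⊛-comm g f) k))

  θ-⊛ : ∀ f g → θ (f ⊛ g) ≐ θ f ⊛ g ⊕ f ⊛ θ g
  θ-⊛ f g zero    = solve 2 (λ a b → con 0ℚ :* (a :* b) := con 0ℚ :* a :* b :+ a :* (con 0ℚ :* b)) refl (f 0) (g 0)
  θ-⊛ f g (suc k) = begin
    natℚ (suc k) * (f 0 * g (suc k) + (f′ ⊛ g) k)
      ≡⟨ cong (_* (f 0 * g (suc k) + (f′ ⊛ g) k)) (natℚ-suc k) ⟩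
    (1ℚ + natℚ k) * (f 0 * g (suc k) + (f′ ⊛ g) k)
      ≡⟨ solve 4 (λ n a b x → (con 1ℚ :+ n) :* (a :* b :+ x) := a :* ((con 1ℚ :+ n) :* b) :+ (n :* x :+ x)) refl
           (natℚ k) (f 0) (g (suc k)) _ ⟩
    f 0 * ((1ℚ + natℚ k) * g (suc k)) + (natℚ k * (f′ ⊛ g) k + (f′ ⊛ g) k)
      ≡⟨ cong₂ _+_ (cong (λ z → f 0 * (z * g (suc k))) (sym (natℚ-suc k))) (cong (_+ (f′ ⊛ g) k) (θ-⊛ f′ g k)) ⟩
    f 0 * θ g (suc k) + ((θ f′ ⊛ g) k + (f′ ⊛ θ g) k + (f′ ⊛ g) k)
      ≡⟨ solve 5 (λ c a x y z → c :+ (x :+ y :+ z) := (con 0ℚ :* a :+ (x :+ z)) :+ (c :+ y)) refl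
           (f 0 * θ g (suc k)) (g (suc k)) ((θ f′ ⊛ g) k) ((f′ ⊛ θ g) k) ((f′ ⊛ g) k) ⟩
    (0ℚ * g (suc k) + ((θ f′ ⊛ g) k + (f′ ⊛ g) k)) + (f 0 * θ g (suc k) + (f′ ⊛ θ g) k)
      ≡⟨ cong (_+ (f 0 * θ g (suc k) + (f′ ⊛ θ g) k))
           (cong₂ _+_ (cong (_* g (suc k)) (sym (ℚₚ.*-zeroˡ (f 0))))
             (trans (sym (⊛-distribʳ (θ f′) f′ g k)) (⊛-congʳ g tail-θ k))) ⟩
    (θ f ⊛ g) (suc k) + (f ⊛ θ g) (suc k) ∎
    where
    f′ = λ j → f (suc j)
    -- Passing to the tail lowers every index by one, so `θ f′` falls short of the tail of `θ f` by
    -- one copy of `f′`.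
    tail-θ : θ f′ ⊕ f′ ≐ (λ j → θ f (suc j))
    tail-θ j = trans (solve 2 (λ n a → n :* a :+ a := (con 1ℚ :+ n) :* a) refl (natℚ j) (f (suc j)))
      (cong (_* f (suc j)) (sym (natℚ-suc j)))

  scale-⊛ : ∀ c f g → scale c (f ⊛ g) ≐ scale c f ⊛ scale c g
  scale-⊛ c f g zero    = solve 2 (λ a b → con 1ℚ :* (a :* b) := con 1ℚ :* a :* (con 1ℚ :* b)) refl (f 0) (g 0)
  scale-⊛ c f g (suc k) = begin
    c * powℚ c k * (f 0 * g (suc k) + (f′ ⊛ g) k)
      ≡⟨ solve 5 (λ c p a b x → c :* p :* (a :* b :+ x) := con 1ℚ :* a :* (c :* p :* b) :+ c :* (p :* x)) refl
           c (powℚ c k) (f 0) (g (suc k)) _ ⟩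
    1ℚ * f 0 * (c * powℚ c k * g (suc k)) + c * (powℚ c k * (f′ ⊛ g) k)
      ≡⟨ cong (λ z → (1ℚ * f 0 * (c * powℚ c k * g (suc k))) + z)
           (trans (cong (c *_) (scale-⊛ c f′ g k)) (trans (sym (·-⊛ c (scale c f′) (scale c g) k))
             (⊛-congʳ (scale c g) (λ j → sym (ℚₚ.*-assoc c (powℚ c j) (f (suc j)))) k))) ⟩
    (scale c f ⊛ scale c g) (suc k) ∎
    where f′ = λ j → f (suc j)

  -- Factorials and the exponential series

  natℚ*invFact : ∀ k → natℚ (k ℕ.!) * invFact k ≡ 1ℚ
  natℚ*invFact k = natℚ*1/n (k ℕ.!) {{k ℕₚ.!≢0}}

  natℚ*invℕ : ∀ n → natℚ (suc n) * invℕ (suc n) ≡ 1ℚ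
  natℚ*invℕ n = natℚ*1/n (suc n)

  natℚ-cancel : ∀ n .{{_ : ℕ.NonZero n}} {x y} → natℚ n * x ≡ natℚ n * y → x ≡ y
  natℚ-cancel n {x} {y} eq = begin
    x                            ≡⟨ lem x ⟩
    + 1 / n * (natℚ n * x)       ≡⟨ cong (+ 1 / n *_) eq ⟩
    + 1 / n * (natℚ n * y)       ≡⟨ lem y ⟨
    y                            ∎
    where
    lem : ∀ z → z ≡ + 1 / n * (natℚ n * z)
    lem z = sym (trans (solve 3 (λ i n z → i :* (n :* z) := n :* i :* z) refl (+ 1 / n) (natℚ n) z)
      (trans (cong (_* z) (natℚ*1/n n)) (ℚₚ.*-identityˡ z)))

  invFact-suc : ∀ k → natℚ (suc k) * invFact (suc k) ≡ invFact k
  invFact-suc k = natℚ-cancel (k ℕ.!) {{k ℕₚ.!≢0}} (begin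
    natℚ (k ℕ.!) * (natℚ (suc k) * invFact (suc k))
      ≡⟨ solve 3 (λ a b c → a :* (b :* c) := b :* a :* c) refl (natℚ (k ℕ.!)) (natℚ (suc k)) (invFact (suc k)) ⟩
    natℚ (suc k) * natℚ (k ℕ.!) * invFact (suc k)
      ≡⟨ cong (_* invFact (suc k)) (sym (natℚ-* (suc k) (k ℕ.!))) ⟩
    natℚ (suc k ℕ.!) * invFact (suc k)  ≡⟨ natℚ*invFact (suc k) ⟩
    1ℚ                                  ≡⟨ sym (natℚ*invFact k) ⟩
    natℚ (k ℕ.!) * invFact k            ∎)

  C*k![n∸k]! : ∀ {n k} → k ℕ.≤ n → (n C k) ℕ.* (k ℕ.! ℕ.* (n ∸ k) ℕ.!) ≡ n ℕ.!
  C*k![n∸k]! {n} {k} k≤n = trans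
    (cong (ℕ._* (k ℕ.! ℕ.* (n ∸ k) ℕ.!)) (nCk≡n!/k![n-k]! k≤n))
    (ℕ.m/n*n≡m {{k ℕₚ.!* (n ∸ k) !≢0}} (k![n∸k]!∣n! k≤n))

  -- Converts the binomial recursion of the Bernoulli numbers into a Cauchy product of exponential
  -- generating functions.
  C-invFact : ∀ {n k} → k ℕ.≤ n → natℚ (n C k) * invFact n ≡ invFact k * invFact (n ∸ k)
  C-invFact {n} {k} k≤n = begin
    c * v          ≡⟨ solve 2 (λ c v → c :* v := c :* v :* con 1ℚ :* con 1ℚ) refl c v ⟩
    c * v * 1ℚ * 1ℚ
      ≡⟨ cong₂ (λ s t → c * v * s * t) (sym (natℚ*invFact k)) (sym (natℚ*invFact (n ∸ k))) ⟩
    c * v * (natℚ (k ℕ.!) * x) * (natℚ ((n ∸ k) ℕ.!) * y)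
      ≡⟨ solve 6 (λ c v p x q y → c :* v :* (p :* x) :* (q :* y) := c :* (p :* q) :* v :* (x :* y)) refl
           c v (natℚ (k ℕ.!)) x (natℚ ((n ∸ k) ℕ.!)) y ⟩
    c * (natℚ (k ℕ.!) * natℚ ((n ∸ k) ℕ.!)) * v * (x * y)
      ≡⟨ cong (λ z → z * v * (x * y)) (trans (cong (c *_) (sym (natℚ-* (k ℕ.!) ((n ∸ k) ℕ.!))))
           (trans (sym (natℚ-* (n C k) (k ℕ.! ℕ.* (n ∸ k) ℕ.!))) (cong natℚ (C*k![n∸k]! k≤n)))) ⟩
    natℚ (n ℕ.!) * v * (x * y)
      ≡⟨ trans (cong (_* (x * y)) (natℚ*invFact n)) (ℚₚ.*-identityˡ _) ⟩
    x * y ∎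
    where
    c = natℚ (n C k)
    v = invFact n
    x = invFact k
    y = invFact (n ∸ k)

  Exp : ℚ → Series
  Exp t k = powℚ t k * invFact k

  Exp-suc : ∀ t k → natℚ (suc k) * Exp t (suc k) ≡ t * Exp t k
  Exp-suc t k = trans
    (solve 4 (λ n t p i → n :* (t :* p :* i) := t :* (p :* (n :* i))) refl (natℚ (suc k)) t (powℚ t k) (invFact (suc k)))
    (cong (λ z → t * (powℚ t k * z)) (invFact-suc k))

  θ-Exp : ∀ t → θ (Exp t) ≐ t · shift (Exp t)
  θ-Exp t zero    = trans (ℚₚ.*-zeroˡ (Exp t 0)) (sym (ℚₚ.*-zeroʳ t))
  θ-Exp t (suc k) = Exp-suc t k

  -- The equation x f′ = t x f determines the coefficient of index k + 1 from that of index k, as k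
  -- + 1 is invertible.
  Exp-unique : ∀ t f → f 0 ≡ 1ℚ → θ f ≐ t · shift f → f ≐ Exp t
  Exp-unique t f p q zero    = trans p (sym (ℚₚ.*-identityʳ 1ℚ))
  Exp-unique t f p q (suc k) = natℚ-cancel (suc k) (trans (q (suc k))
    (trans (cong (t *_) (Exp-unique t f p q k)) (sym (Exp-suc t k))))

  ⊛-· : ∀ c f g → f ⊛ (c · g) ≐ c · (f ⊛ g)
  ⊛-· c f g k = trans (⊛-comm f (c · g) k) (trans (·-⊛ c g f k) (cong (c *_) (⊛-comm g f k)))

  -- By the Leibniz rule the product solves the differential equation of `Exp (s + t)`, which
  -- replaces the binomial theorem.
  Exp-⊛ : ∀ s t → Exp s ⊛ Exp t ≐ Exp (s + t)
  Exp-⊛ s t = Exp-unique (s + t) (Exp s ⊛ Exp t) refl λ k → begin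
    θ (Exp s ⊛ Exp t) k
      ≡⟨ θ-⊛ (Exp s) (Exp t) k ⟩
    (θ (Exp s) ⊛ Exp t) k + (Exp s ⊛ θ (Exp t)) k
      ≡⟨ cong₂ _+_
           (trans (⊛-congʳ (Exp t) (θ-Exp s) k) (trans (·-⊛ s (shift (Exp s)) (Exp t) k)
             (cong (s *_) (shift-⊛ (Exp s) (Exp t) k))))
           (trans (⊛-congˡ (Exp s) (θ-Exp t) k) (trans (⊛-· t (Exp s) (shift (Exp t)) k)
             (cong (t *_) (⊛-shift (Exp s) (Exp t) k)))) ⟩
    s * shift (Exp s ⊛ Exp t) k + t * shift (Exp s ⊛ Exp t) k
      ≡⟨ sym (ℚₚ.*-distribʳ-+ (shift (Exp s ⊛ Exp t) k) s t) ⟩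
    (s + t) * shift (Exp s ⊛ Exp t) k ∎

  powℚ-1 : ∀ k → powℚ 1ℚ k ≡ 1ℚ
  powℚ-1 zero    = refl
  powℚ-1 (suc k) = trans (ℚₚ.*-identityˡ _) (powℚ-1 k)

  scale-Exp : ∀ c → scale c (Exp 1ℚ) ≐ Exp c
  scale-Exp c k = cong (powℚ c k *_) (trans (cong (_* invFact k) (powℚ-1 k)) (ℚₚ.*-identityˡ _))

  -- Bernoulli numbers and their generating function

  -- x / (exp x − 1)
  β : Series
  β k = bernoulli k * invFact k

  sumFinℚ : ∀ n → (Fin n → ℚ) → ℚ
  sumFinℚ zero f = 0ℚ
  sumFinℚ (suc n) f = f zero + sumFinℚ n (λ i → f (suc i))

  bernTerm : ∀ m → Fin (suc m) → ℚ
  bernTerm m k = natℚ (suc (suc m) C toℕ k) * bernTable m (opposite k)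

  -- As the local sum of bernTable cannot be named here, a wildcard stands for it: the
  -- with-abstraction turns its arguments into variables, from which unification recovers it.
  mutual
    bernTable-suc : ∀ m → bernTable (suc m) zero ≡ - (invℕ (suc (suc m)) *
          sumFinℚ (suc m) (bernTerm m))
    localSum≡sumFinℚ : ∀ m n f → _ ≡ sumFinℚ n f

    bernTable-suc zero = refl
    bernTable-suc (suc m) with suc m | (λ (i : Fin m) → bernTerm (suc m) (suc (suc i))) | bernTerm (suc m) zero | bernTerm (suc m) (suc zero) | invℕ (suc (suc (suc m)))
    ... | k | f | x | y | z = cong (λ w → - (z * (x + (y + w)))) (localSum≡sumFinℚ k m f)

    localSum≡sumFinℚ m zero f = refl
    localSum≡sumFinℚ m (suc n) f = cong (λ z → f zero + z) (localSum≡sumFinℚ m n (λ i → f (suc i)))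

  sumℚ-cong : ∀ n {f g} → (∀ k → k ℕ.< n → f k ≡ g k) → sumℚ n f ≡ sumℚ n g
  sumℚ-cong zero    p = refl
  sumℚ-cong (suc n) p = cong₂ _+_ (sumℚ-cong n (λ k k<n → p k (ℕₚ.m<n⇒m<1+n k<n))) (p n ℕₚ.≤-refl)

  sumℚ-*ʳ : ∀ n f c → sumℚ n f * c ≡ sumℚ n (λ k → f k * c)
  sumℚ-*ʳ zero    f c = ℚₚ.*-zeroˡ c
  sumℚ-*ʳ (suc n) f c = trans (ℚₚ.*-distribʳ-+ c (sumℚ n f) (f n)) (cong (_+ f n * c) (sumℚ-*ʳ n f c))

  sumℚ-head : ∀ n f → sumℚ (suc n) f ≡ f 0 + sumℚ n (λ k → f (suc k))
  sumℚ-head zero    f = trans (ℚₚ.+-identityˡ (f 0)) (sym (ℚₚ.+-identityʳ (f 0)))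
  sumℚ-head (suc n) f = trans (cong (_+ f (suc n)) (sumℚ-head n f)) (ℚₚ.+-assoc (f 0) _ _)

  sumFinℚ≡sumℚ : ∀ n (f : Fin n → ℚ) (g : ℕ → ℚ) → (∀ i → f i ≡ g (toℕ i)) → sumFinℚ n f ≡ sumℚ n g
  sumFinℚ≡sumℚ zero    f g p = refl
  sumFinℚ≡sumℚ (suc n) f g p = trans
    (cong₂ _+_ (p zero) (sumFinℚ≡sumℚ n (λ i → f (suc i)) (λ k → g (suc k)) (λ i → p (suc i))))
    (sym (sumℚ-head n g))

  ⊛≡sumℚ : ∀ f g k → (f ⊛ g) k ≡ sumℚ (suc k) (λ j → f j * g (k ∸ j))
  ⊛≡sumℚ f g zero    = sym (ℚₚ.+-identityˡ _)
  ⊛≡sumℚ f g (suc k) = trans (cong (λ z → f 0 * g (suc k) + z) (⊛≡sumℚ (λ j → f (suc j)) g k))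
    (sym (sumℚ-head (suc k) (λ j → f j * g (suc k ∸ j))))

  bernTable≡bernoulli : ∀ m i → bernTable m i ≡ bernoulli (m ∸ toℕ i)
  bernTable≡bernoulli m       zero    = refl
  bernTable≡bernoulli (suc m) (suc i) = bernTable≡bernoulli m i

  -- The last summand has coefficient C(m+2, m+1) = m + 2, which cancels the 1/(m+2) in the
  -- recursion for `bernoulli (suc m)` and leaves minus the sum of the others.
  bernoulli-rec : ∀ m → sumℚ (suc (suc m)) (λ k → natℚ (suc (suc m) C k) * bernoulli k) ≡ 0ℚ
  bernoulli-rec m = begin
    T + natℚ (suc (suc m) C suc m) * bernoulli (suc m)
      ≡⟨ cong₂ (λ x y → T + natℚ x * y) C≡ (bernTable-suc m) ⟩
    T + N * - (invℕ (suc (suc m)) * sumFinℚ (suc m) (bernTerm m))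
      ≡⟨ cong (λ z → T + N * - (invℕ (suc (suc m)) * z)) T≡ ⟩
    T + N * - (invℕ (suc (suc m)) * T)
      ≡⟨ solve 3 (λ t n i → t :+ n :* (:- (i :* t)) := t :- n :* i :* t) refl T N (invℕ (suc (suc m))) ⟩
    T - N * invℕ (suc (suc m)) * T
      ≡⟨ cong (λ z → T - z * T) (natℚ*invℕ (suc m)) ⟩
    T - 1ℚ * T
      ≡⟨ solve 1 (λ t → t :- con 1ℚ :* t := con 0ℚ) refl T ⟩
    0ℚ ∎
    where
    N = natℚ (suc (suc m))
    T = sumℚ (suc m) (λ k → natℚ (suc (suc m) C k) * bernoulli k)
    C≡ : suc (suc m) C suc m ≡ suc (suc m)
    C≡ = trans (nCk≡nC[n∸k] {suc m} {suc (suc m)} (ℕₚ.n≤1+n (suc m)))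
      (trans (cong (suc (suc m) C_) (trans (ℕₚ.+-∸-assoc 1 {m} ℕₚ.≤-refl) (cong suc (ℕₚ.n∸n≡0 m)))) (nC1≡n (suc (suc m))))
    T≡ : sumFinℚ (suc m) (bernTerm m) ≡ T
    T≡ = sumFinℚ≡sumℚ (suc m) (bernTerm m) _ λ i → cong (natℚ (suc (suc m) C toℕ i) *_)
      (trans (bernTable≡bernoulli m (opposite i)) (cong bernoulli (trans (cong (m ∸_) (Finₚ.opposite-prop i))
        (ℕₚ.m∸[m∸n]≡n (ℕₚ.≤-pred (Finₚ.toℕ<n i))))))

  -- The equation β (exp x - 1) = x, free of subtraction. In degree n ≥ 2 the terms below n cancel
  -- by `bernoulli-rec` and the last term is β n; degrees 0 and 1 are computed.
  β-Exp : β ⊛ Exp 1ℚ ≐ β ⊕ shift one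
  β-Exp zero          = refl
  β-Exp (suc zero)    = refl
  β-Exp (suc (suc m)) = begin
    (β ⊛ Exp 1ℚ) n
      ≡⟨ ⊛≡sumℚ β (Exp 1ℚ) n ⟩
    sumℚ n term + term n
      ≡⟨ cong₂ _+_ (trans (sumℚ-cong n (λ k k<n → term≡ k (ℕₚ.<⇒≤ k<n)))
           (trans (sym (sumℚ-*ʳ n _ (invFact n))) (trans (cong (_* invFact n) (bernoulli-rec m)) (ℚₚ.*-zeroˡ (invFact n)))))
         (trans (term≡ n ℕₚ.≤-refl) (trans (cong (λ z → natℚ z * bernoulli n * invFact n) (nCn≡1 n))
           (cong (_* invFact n) (ℚₚ.*-identityˡ (bernoulli n))))) ⟩
    0ℚ + β n
      ≡⟨ ℚₚ.+-comm 0ℚ (β n) ⟩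
    β n + 0ℚ ∎
    where
    n = suc (suc m)
    term : ℕ → ℚ
    term k = β k * Exp 1ℚ (n ∸ k)
    term≡ : ∀ k → k ℕ.≤ n → term k ≡ natℚ (n C k) * bernoulli k * invFact n
    term≡ k k≤n = begin
      bernoulli k * invFact k * (powℚ 1ℚ (n ∸ k) * invFact (n ∸ k))
        ≡⟨ cong (λ z → bernoulli k * invFact k * (z * invFact (n ∸ k))) (powℚ-1 (n ∸ k)) ⟩
      bernoulli k * invFact k * (1ℚ * invFact (n ∸ k))
        ≡⟨ solve 3 (λ b x y → b :* x :* (con 1ℚ :* y) := b :* (x :* y)) refl (bernoulli k) (invFact k) (invFact (n ∸ k)) ⟩
      bernoulli k * (invFact k * invFact (n ∸ k))
        ≡⟨ cong (bernoulli k *_) (sym (C-invFact k≤n)) ⟩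
      bernoulli k * (natℚ (n C k) * invFact n)
        ≡⟨ solve 3 (λ b c i → b :* (c :* i) := c :* b :* i) refl (bernoulli k) (natℚ (n C k)) (invFact n) ⟩
      natℚ (n C k) * bernoulli k * invFact n ∎

  θ-shift-one : θ (shift one) ≐ shift one
  θ-shift-one zero          = refl
  θ-shift-one (suc zero)    = refl
  θ-shift-one (suc (suc k)) = ℚₚ.*-zeroʳ (natℚ (suc (suc k)))

  θ-cong : ∀ {f g} → f ≐ g → θ f ≐ θ g
  θ-cong p k = cong (natℚ k *_) (p k)

  θ-⊕ : ∀ f g → θ (f ⊕ g) ≐ θ f ⊕ θ g
  θ-⊕ f g k = ℚₚ.*-distribˡ-+ (natℚ k) (f k) (g k)

  -- Apply θ to β (exp x − 1) = x, multiply by β and cancel x.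
  β²-Exp : β ⊛ (β ⊛ Exp 1ℚ) ⊕ θ β ≐ β
  β²-Exp k = begin
    (β ⊛ w) k + θ β k
      ≡⟨ solve 3 (λ a b c → a :+ b := (a :+ c :+ b) :- c) refl ((β ⊛ w) k) (θ β k) ((β ⊛ θ β) (suc k)) ⟩
    (β ⊛ w) k + (β ⊛ θ β) (suc k) + θ β k - (β ⊛ θ β) (suc k)
      ≡⟨ cong (_- (β ⊛ θ β) (suc k)) multiplied ⟩
    (β ⊛ θ β) (suc k) + β k - (β ⊛ θ β) (suc k)
      ≡⟨ solve 2 (λ a b → a :+ b :- a := b) refl ((β ⊛ θ β) (suc k)) (β k) ⟩
    β k ∎
    where
    w = β ⊛ Exp 1ℚ
    shift-one-⊛ : ∀ f → shift one ⊛ f ≐ shift f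
    shift-one-⊛ f j = trans (shift-⊛ one f j) (shift-cong (⊛-identityˡ f) j)
    derived : θ β ⊛ Exp 1ℚ ⊕ shift w ≐ θ β ⊕ shift one
    derived j = begin
      (θ β ⊛ Exp 1ℚ) j + shift w j
        ≡⟨ cong (λ z → (θ β ⊛ Exp 1ℚ) j + z) (sym (trans (⊛-congˡ β (θ-Exp 1ℚ) j)
             (trans (⊛-congˡ β (λ i → ℚₚ.*-identityˡ (shift (Exp 1ℚ) i)) j) (⊛-shift β (Exp 1ℚ) j)))) ⟩
      (θ β ⊛ Exp 1ℚ) j + (β ⊛ θ (Exp 1ℚ)) j
        ≡⟨ sym (θ-⊛ β (Exp 1ℚ) j) ⟩
      θ w j
        ≡⟨ trans (θ-cong β-Exp j) (θ-⊕ β (shift one) j) ⟩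
      θ β j + θ (shift one) j
        ≡⟨ cong (λ z → θ β j + z) (θ-shift-one j) ⟩
      θ β j + shift one j ∎
    rotate : β ⊛ (θ β ⊛ Exp 1ℚ) ≐ β ⊛ θ β ⊕ shift (θ β)
    rotate j = begin
      (β ⊛ (θ β ⊛ Exp 1ℚ)) j
        ≡⟨ ⊛-congˡ β (⊛-comm (θ β) (Exp 1ℚ)) j ⟩
      (β ⊛ (Exp 1ℚ ⊛ θ β)) j
        ≡⟨ sym (⊛-assoc β (Exp 1ℚ) (θ β) j) ⟩
      (w ⊛ θ β) j
        ≡⟨ ⊛-congʳ (θ β) β-Exp j ⟩
      ((β ⊕ shift one) ⊛ θ β) j
        ≡⟨ ⊛-distribʳ β (shift one) (θ β) j ⟩
      (β ⊛ θ β) j + (shift one ⊛ θ β) j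
        ≡⟨ cong (λ z → (β ⊛ θ β) j + z) (shift-one-⊛ (θ β) j) ⟩
      (β ⊛ θ β) j + shift (θ β) j ∎
    multiplied : (β ⊛ w) k + (β ⊛ θ β) (suc k) + θ β k ≡ (β ⊛ θ β) (suc k) + β k
    multiplied = begin
      (β ⊛ w) k + (β ⊛ θ β) (suc k) + θ β k
        ≡⟨ solve 3 (λ a b c → a :+ b :+ c := b :+ c :+ a) refl ((β ⊛ w) k) ((β ⊛ θ β) (suc k)) (θ β k) ⟩
      (β ⊛ θ β) (suc k) + θ β k + (β ⊛ w) k
        ≡⟨ cong₂ _+_ (sym (rotate (suc k))) (sym (⊛-shift β w (suc k))) ⟩
      (β ⊛ (θ β ⊛ Exp 1ℚ)) (suc k) + (β ⊛ shift w) (suc k)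
        ≡⟨ sym (⊛-distribˡ β (θ β ⊛ Exp 1ℚ) (shift w) (suc k)) ⟩
      (β ⊛ (θ β ⊛ Exp 1ℚ ⊕ shift w)) (suc k)
        ≡⟨ ⊛-congˡ β derived (suc k) ⟩
      (β ⊛ (θ β ⊕ shift one)) (suc k)
        ≡⟨ ⊛-distribˡ β (θ β) (shift one) (suc k) ⟩
      (β ⊛ θ β) (suc k) + (β ⊛ shift one) (suc k)
        ≡⟨ cong (λ z → (β ⊛ θ β) (suc k) + z) (trans (⊛-comm β (shift one) (suc k)) (shift-one-⊛ β (suc k))) ⟩
      (β ⊛ θ β) (suc k) + β k ∎

  -- The polynomial part as a coefficient of a power series

  -- The product of the series β(a x), whose coefficients are the inner sums over k₁ + ⋯ + k_d = m
  -- of `poly`.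
  bernProd : List ℕ → Series
  bernProd []      = one
  bernProd (a ∷ L) = scale (natℚ a) β ⊛ bernProd L

  bernProd-↭ : ∀ {L M} → L ↭ M → bernProd L ≐ bernProd M
  bernProd-↭ Perm.refl          k = refl
  bernProd-↭ (prep a p)         k = ⊛-congˡ (scale (natℚ a) β) (bernProd-↭ p) k
  bernProd-↭ (swap {L} {M} a b p) k = begin
    (A ⊛ (B ⊛ bernProd L)) k   ≡⟨ sym (⊛-assoc A B (bernProd L) k) ⟩
    (A ⊛ B ⊛ bernProd L) k     ≡⟨ ⊛-cong (⊛-comm A B) (bernProd-↭ p) k ⟩
    (B ⊛ A ⊛ bernProd M) k     ≡⟨ ⊛-assoc B A (bernProd M) k ⟩
    (B ⊛ (A ⊛ bernProd M)) k   ∎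
    where
    A = scale (natℚ a) β
    B = scale (natℚ b) β
  bernProd-↭ (Perm.trans p q)   k = trans (bernProd-↭ p k) (bernProd-↭ q k)

  -- poly_L(−n); the sign (−1)^(d−1) comes from replacing e^{−nx} and β(−a x) by e^{nx} and β(a x).
  -- The shift makes the coefficient of index d − 1 equal to 0 when d = 0.
  polyNeg : List ℕ → ℤ → ℚ
  polyNeg L n = - (invℕ (product L) * (powℚ (- 1ℚ) (length L) * shift (bernProd L ⊛ Exp (n / 1)) (length L)))

  polyNeg-↭ : ∀ {L M} → L ↭ M → ∀ n → polyNeg L n ≡ polyNeg M n
  polyNeg-↭ {L} {M} p n = cong -_ (cong₂ _*_ (cong invℕ (product-↭ p))
    (trans (cong (powℚ (- 1ℚ) (length L) *_) (shift-cong (⊛-congʳ (Exp (n / 1)) (bernProd-↭ p)) (length L)))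
      (cong (λ d → powℚ (- 1ℚ) d * shift (bernProd M ⊛ Exp (n / 1)) d) (Permₚ.↭-length p))))

  -- `β-Exp` after the substitution of c x for x, which is multiplicative and turns exp x into exp
  -- (c x).
  scale-β-Exp : ∀ c → scale c β ⊛ Exp c ≐ scale c β ⊕ c · shift one
  scale-β-Exp c k = begin
    (scale c β ⊛ Exp c) k               ≡⟨ ⊛-congˡ (scale c β) (λ j → sym (scale-Exp c j)) k ⟩
    (scale c β ⊛ scale c (Exp 1ℚ)) k    ≡⟨ sym (scale-⊛ c β (Exp 1ℚ) k) ⟩
    scale c (β ⊛ Exp 1ℚ) k              ≡⟨ cong (powℚ c k *_) (β-Exp k) ⟩
    powℚ c k * (β k + shift one k)      ≡⟨ ℚₚ.*-distribˡ-+ (powℚ c k) (β k) (shift one k) ⟩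
    scale c β k + powℚ c k * shift one k ≡⟨ cong (λ z → scale c β k + z) (linear k) ⟩
    scale c β k + c * shift one k       ∎
    where
    linear : ∀ k → powℚ c k * shift one k ≡ c * shift one k
    linear zero          = trans (ℚₚ.*-zeroʳ 1ℚ) (sym (ℚₚ.*-zeroʳ c))
    linear (suc zero)    = cong (_* 1ℚ) (ℚₚ.*-identityʳ c)
    linear (suc (suc k)) = trans (ℚₚ.*-zeroʳ (powℚ c (suc (suc k)))) (sym (ℚₚ.*-zeroʳ c))

  bernProd-Exp-diff : ∀ a L n → bernProd (a ∷ L) ⊛ Exp ((n ℤ.+ + a) / 1)
    ≐ bernProd (a ∷ L) ⊛ Exp (n / 1) ⊕ natℚ a · shift (bernProd L ⊛ Exp (n / 1))
  bernProd-Exp-diff a L n k = begin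
    (A ⊛ G ⊛ Exp ((n ℤ.+ + a) / 1)) k
      ≡⟨ ⊛-congˡ (A ⊛ G) (λ j → trans (cong (λ t → Exp t j) (trans (/1-homo-+ n (+ a)) (ℚₚ.+-comm (n / 1) c)))
           (sym (Exp-⊛ c (n / 1) j))) k ⟩
    (A ⊛ G ⊛ (Exp c ⊛ E)) k
      ≡⟨ ⊛-congʳ (Exp c ⊛ E) (⊛-comm A G) k ⟩
    (G ⊛ A ⊛ (Exp c ⊛ E)) k
      ≡⟨ trans (⊛-assoc G A (Exp c ⊛ E) k) (⊛-congˡ G (λ j → sym (⊛-assoc A (Exp c) E j)) k) ⟩
    (G ⊛ (A ⊛ Exp c ⊛ E)) k
      ≡⟨ ⊛-congˡ G (λ j → trans (⊛-congʳ E (scale-β-Exp c) j) (⊛-distribʳ A (c · shift one) E j)) k ⟩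
    (G ⊛ (A ⊛ E ⊕ (c · shift one) ⊛ E)) k
      ≡⟨ ⊛-distribˡ G (A ⊛ E) ((c · shift one) ⊛ E) k ⟩
    (G ⊛ (A ⊛ E)) k + (G ⊛ ((c · shift one) ⊛ E)) k
      ≡⟨ cong₂ _+_ (trans (sym (⊛-assoc G A E k)) (⊛-congʳ E (⊛-comm G A) k))
           (trans (⊛-congˡ G (λ j → trans (·-⊛ c (shift one) E j) (cong (c *_)
             (trans (shift-⊛ one E j) (shift-cong (⊛-identityˡ E) j)))) k)
           (trans (⊛-· c G (shift E) k) (cong (c *_) (⊛-shift G E k)))) ⟩
    (A ⊛ G ⊛ E) k + c * shift (G ⊛ E) k ∎
    where
    c = natℚ a
    A = scale c β
    G = bernProd L
    E = Exp (n / 1)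

  -- In `bernProd-Exp-diff` the factor a cancels against the product of the sizes, the shift lowers
  -- the coefficient index to the one belonging to L, and the extra sign makes the difference
  -- positive.
  polyNeg-diff : ∀ a L n → 1 ℕ.≤ a → 1 ℕ.≤ product L →
    polyNeg (a ∷ L) n ≡ polyNeg (a ∷ L) (n ℤ.+ + a) + polyNeg L n
  polyNeg-diff a L n 1≤a 1≤p = begin
    - (i * (- 1ℚ * s * x))
      ≡⟨ solve 5 (λ i s x y c → :- (i :* (:- con 1ℚ :* s :* x)) :=
           :- (i :* (:- con 1ℚ :* s :* (x :+ c :* y))) :+ (:- (c :* i :* (s :* y)))) refl i s x y c ⟩
    - (i * (- 1ℚ * s * (x + c * y))) + - (c * i * (s * y))
      ≡⟨ cong₂ (λ u v → - (i * (- 1ℚ * s * u)) + - (v * (s * y))) (sym (bernProd-Exp-diff a L n (length L)))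
           (inv-step a (product L) 1≤a 1≤p) ⟩
    polyNeg (a ∷ L) (n ℤ.+ + a) + polyNeg L n ∎
    where
    i = invℕ (a ℕ.* product L)
    s = powℚ (- 1ℚ) (length L)
    x = (bernProd (a ∷ L) ⊛ Exp (n / 1)) (length L)
    y = shift (bernProd L ⊛ Exp (n / 1)) (length L)
    c = natℚ a
    inv-step : ∀ a p → 1 ℕ.≤ a → 1 ℕ.≤ p → natℚ a * invℕ (a ℕ.* p) ≡ invℕ p
    inv-step (suc a) (suc p) _ _ = natℚ-cancel (suc p) (begin
      natℚ (suc p) * (natℚ (suc a) * invℕ (suc a ℕ.* suc p))
        ≡⟨ solve 3 (λ p a i → p :* (a :* i) := a :* p :* i) refl (natℚ (suc p)) (natℚ (suc a)) (invℕ (suc a ℕ.* suc p)) ⟩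
      natℚ (suc a) * natℚ (suc p) * invℕ (suc a ℕ.* suc p)
        ≡⟨ cong (_* invℕ (suc a ℕ.* suc p)) (sym (natℚ-* (suc a) (suc p))) ⟩
      natℚ (suc a ℕ.* suc p) * invℕ (suc a ℕ.* suc p)
        ≡⟨ natℚ*invℕ (p ℕ.+ a ℕ.* suc p) ⟩
      1ℚ
        ≡⟨ sym (natℚ*invℕ p) ⟩
      natℚ (suc p) * invℕ (suc p) ∎)

  polyNeg-single : ∀ a n → polyNeg (a ∷ []) n ≡ invℕ a
  polyNeg-single a n = trans (cong (λ z → - (invℕ z * (- 1ℚ * 1ℚ * (1ℚ * 1ℚ * 1ℚ * 1ℚ)))) (ℕₚ.*-identityʳ a))
    (solve 1 (λ i → :- (i :* (:- con 1ℚ :* con 1ℚ :* (con 1ℚ :* con 1ℚ :* con 1ℚ :* con 1ℚ))) := i) refl (invℕ a))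

  -- Powers of β and the list of ones

  infixr 8 _^⊛_
  _^⊛_ : Series → ℕ → Series
  f ^⊛ zero  = one
  f ^⊛ suc k = f ⊛ f ^⊛ k

  θ-^⊛ : ∀ f k → θ (f ^⊛ suc k) ≐ natℚ (suc k) · (f ^⊛ k ⊛ θ f)
  θ-^⊛ f zero    j = begin
    θ (f ⊛ one) j          ≡⟨ θ-cong (λ i → trans (⊛-comm f one i) (⊛-identityˡ f i)) j ⟩
    θ f j                  ≡⟨ sym (trans (ℚₚ.*-identityˡ _) (⊛-identityˡ (θ f) j)) ⟩
    1ℚ * (one ⊛ θ f) j     ∎
  θ-^⊛ f (suc k) j = begin
    θ (f ⊛ g) j
      ≡⟨ θ-⊛ f g j ⟩
    (θ f ⊛ g) j + (f ⊛ θ g) j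
      ≡⟨ cong₂ _+_ (⊛-comm (θ f) g j) (trans (⊛-congˡ f (θ-^⊛ f k) j)
           (trans (⊛-· (natℚ (suc k)) f (f ^⊛ k ⊛ θ f) j) (cong (natℚ (suc k) *_) (sym (⊛-assoc f (f ^⊛ k) (θ f) j))))) ⟩
    (g ⊛ θ f) j + natℚ (suc k) * (g ⊛ θ f) j
      ≡⟨ solve 2 (λ n x → x :+ n :* x := (con 1ℚ :+ n) :* x) refl (natℚ (suc k)) ((g ⊛ θ f) j) ⟩
    (1ℚ + natℚ (suc k)) * (g ⊛ θ f) j
      ≡⟨ cong (_* (g ⊛ θ f) j) (sym (natℚ-suc (suc k))) ⟩
    natℚ (suc (suc k)) * (g ⊛ θ f) j ∎
    where g = f ^⊛ suc k

  bernProd-ones : ∀ d → bernProd (replicate d 1) ≐ β ^⊛ d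
  bernProd-ones zero    k = refl
  bernProd-ones (suc d) k = ⊛-cong (λ j → trans (cong (_* β j) (powℚ-1 j)) (ℚₚ.*-identityˡ (β j))) (bernProd-ones d) k

  -- By `β²-Exp` the series is β^(k+1) - β^k θβ. The power rule makes (k+1) β^k θβ equal to
  -- θ(β^(k+1)), and θ multiplies the coefficient of x^(k+1) by k + 1, so both parts have the same
  -- coefficient in that degree.
  β^-Exp : ∀ k → (β ^⊛ suc (suc k) ⊛ Exp 1ℚ) (suc k) ≡ 0ℚ
  β^-Exp k = natℚ-cancel (suc k) (begin
    natℚ (suc k) * (β ^⊛ suc (suc k) ⊛ Exp 1ℚ) (suc k)
      ≡⟨ cong (natℚ (suc k) *_) expand ⟩
    natℚ (suc k) * (u - v)
      ≡⟨ solve 3 (λ n u v → n :* (u :- v) := n :* u :- n :* v) refl (natℚ (suc k)) u v ⟩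
    natℚ (suc k) * u - natℚ (suc k) * v
      ≡⟨ cong (_- natℚ (suc k) * v) (θ-^⊛ β k (suc k)) ⟩
    natℚ (suc k) * v - natℚ (suc k) * v
      ≡⟨ solve 2 (λ n v → n :* v :- n :* v := n :* con 0ℚ) refl (natℚ (suc k)) v ⟩
    natℚ (suc k) * 0ℚ ∎)
    where
    B = β ^⊛ k
    u = (β ^⊛ suc k) (suc k)
    v = (B ⊛ θ β) (suc k)
    reassoc : β ⊛ (β ⊛ B) ⊛ Exp 1ℚ ≐ B ⊛ (β ⊛ (β ⊛ Exp 1ℚ))
    reassoc j = begin
      (β ⊛ (β ⊛ B) ⊛ Exp 1ℚ) j     ≡⟨ ⊛-congʳ (Exp 1ℚ) (λ i → trans (sym (⊛-assoc β β B i)) (⊛-comm (β ⊛ β) B i)) j ⟩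
      (B ⊛ (β ⊛ β) ⊛ Exp 1ℚ) j     ≡⟨ ⊛-assoc B (β ⊛ β) (Exp 1ℚ) j ⟩
      (B ⊛ (β ⊛ β ⊛ Exp 1ℚ)) j     ≡⟨ ⊛-congˡ B (⊛-assoc β β (Exp 1ℚ)) j ⟩
      (B ⊛ (β ⊛ (β ⊛ Exp 1ℚ))) j   ∎
    expand : (β ^⊛ suc (suc k) ⊛ Exp 1ℚ) (suc k) ≡ u - v
    expand = begin
      (β ⊛ (β ⊛ B) ⊛ Exp 1ℚ) (suc k)
        ≡⟨ reassoc (suc k) ⟩
      z
        ≡⟨ solve 2 (λ z v → z := (z :+ v) :- v) refl z v ⟩
      (z + v) - v
        ≡⟨ cong (_- v) (trans (sym (⊛-distribˡ B (β ⊛ (β ⊛ Exp 1ℚ)) (θ β) (suc k)))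
             (trans (⊛-congˡ B β²-Exp (suc k)) (⊛-comm B β (suc k)))) ⟩
      u - v ∎
      where z = (B ⊛ (β ⊛ (β ⊛ Exp 1ℚ))) (suc k)

  polyNeg-ones : ∀ k → polyNeg (replicate (suc (suc k)) 1) (+ 1) ≡ 0ℚ
  polyNeg-ones k = trans (cong (λ z → - (i * (s * z)))
      (trans (⊛-congʳ (Exp 1ℚ) (bernProd-ones (suc (suc k))) (suc (length (replicate k 1))))
        (trans (cong (λ d → (β ^⊛ suc (suc k) ⊛ Exp 1ℚ) (suc d)) (length-replicate k {1})) (β^-Exp k))))
    (solve 2 (λ i s → :- (i :* (s :* con 0ℚ)) := con 0ℚ) refl i s)
    where
    i = invℕ (product (replicate (suc (suc k)) 1))
    s = powℚ (- 1ℚ) (length (replicate (suc (suc k)) 1))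

  -- Agreement with the definition of `poly`

  product-tabulate : ∀ d (a : Fin d → ℕ) → product (tabulate a) ≡ prodℕ d a
  product-tabulate zero    a = refl
  product-tabulate (suc d) a = cong (a zero ℕ.*_) (product-tabulate d (λ i → a (suc i)))

  compSum≡bernProd : ∀ d (a : Fin d → ℕ) →
    compSum d (λ i k → powℚ (natℚ (a i)) k * bernoulli k * invFact k) ≐ bernProd (tabulate a)
  compSum≡bernProd zero    a zero    = refl
  compSum≡bernProd zero    a (suc k) = refl
  compSum≡bernProd (suc d) a k = trans
    (sumℚ-cong (suc k) (λ j _ → cong₂ _*_ (ℚₚ.*-assoc (powℚ (natℚ (a zero)) j) (bernoulli j) (invFact j))
      (compSum≡bernProd d (λ i → a (suc i)) (k ∸ j))))
    (sym (⊛≡sumℚ (scale (natℚ (a zero)) β) (bernProd (tabulate (λ i → a (suc i)))) k))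

  -- Each term of `poly` at a negated argument carries e signs in all, m explicit ones and e - m
  -- from the power, so one common sign leaves the sum.
  powℚ-neg : ∀ t e m → m ℕ.≤ e → powℚ (- 1ℚ) m * powℚ (- t) (e ∸ m) ≡ powℚ (- 1ℚ) e * powℚ t (e ∸ m)
  powℚ-neg t zero    zero    _         = refl
  powℚ-neg t (suc e) zero    _         = trans
    (solve 2 (λ t p → con 1ℚ :* (:- t :* p) := :- t :* (con 1ℚ :* p)) refl t (powℚ (- t) e))
    (trans (cong (- t *_) (powℚ-neg t e zero ℕ.z≤n))
      (solve 3 (λ t s p → :- t :* (s :* p) := :- con 1ℚ :* s :* (t :* p)) refl t (powℚ (- 1ℚ) e) (powℚ t e)))
  powℚ-neg t (suc e) (suc m) (ℕ.s≤s q) = trans (ℚₚ.*-assoc (- 1ℚ) (powℚ (- 1ℚ) m) _)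
    (trans (cong (- 1ℚ *_) (powℚ-neg t e m q)) (sym (ℚₚ.*-assoc (- 1ℚ) (powℚ (- 1ℚ) e) _)))

  -- With the sign pulled out, the sum over m is the Cauchy product of `bernProd` and `Exp` in
  -- degree e.
  poly≡polyNeg : ∀ e (a : Fin (suc e) → ℕ) n → poly (suc e) a (- (n / 1)) ≡ polyNeg (tabulate a) n
  poly≡polyNeg e a n = begin
    invℕ (prodℕ (suc e) a) * sumℚ (suc e) _
      ≡⟨ cong₂ _*_ (cong invℕ (sym (product-tabulate (suc e) a))) (sumℚ-cong (suc e) (λ m m<d → term m (ℕₚ.≤-pred m<d))) ⟩
    i * sumℚ (suc e) (λ m → G m * Exp t (e ∸ m) * s)
      ≡⟨ cong (i *_) (trans (sym (sumℚ-*ʳ (suc e) (λ m → G m * Exp t (e ∸ m)) s))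
           (cong (_* s) (sym (⊛≡sumℚ G (Exp t) e)))) ⟩
    i * ((G ⊛ Exp t) e * s)
      ≡⟨ solve 3 (λ i x s → i :* (x :* s) := :- (i :* (:- con 1ℚ :* s :* x))) refl i ((G ⊛ Exp t) e) s ⟩
    - (i * (powℚ (- 1ℚ) (suc e) * shift (G ⊛ Exp t) (suc e)))
      ≡⟨ cong (λ d → - (i * (powℚ (- 1ℚ) d * shift (G ⊛ Exp t) d))) (sym (length-tabulate a)) ⟩
    polyNeg (tabulate a) n ∎
    where
    t = n / 1
    i = invℕ (product (tabulate a))
    s = powℚ (- 1ℚ) e
    G = bernProd (tabulate a)
    term : ∀ m → m ℕ.≤ e →
      powℚ (- 1ℚ) m * invFact (e ∸ m) * compSum (suc e) (λ i k → powℚ (natℚ (a i)) k * bernoulli k * invFact k) m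
        * powℚ (- t) (e ∸ m) ≡ G m * Exp t (e ∸ m) * s
    term m m≤e = begin
      powℚ (- 1ℚ) m * invFact (e ∸ m) * _ * powℚ (- t) (e ∸ m)
        ≡⟨ cong (λ z → powℚ (- 1ℚ) m * invFact (e ∸ m) * z * powℚ (- t) (e ∸ m)) (compSum≡bernProd (suc e) a m) ⟩
      powℚ (- 1ℚ) m * invFact (e ∸ m) * G m * powℚ (- t) (e ∸ m)
        ≡⟨ solve 4 (λ p v g q → p :* v :* g :* q := v :* g :* (p :* q)) refl
             (powℚ (- 1ℚ) m) (invFact (e ∸ m)) (G m) (powℚ (- t) (e ∸ m)) ⟩
      invFact (e ∸ m) * G m * (powℚ (- 1ℚ) m * powℚ (- t) (e ∸ m))
        ≡⟨ cong (invFact (e ∸ m) * G m *_) (powℚ-neg t e m m≤e) ⟩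
      invFact (e ∸ m) * G m * (s * powℚ t (e ∸ m))
        ≡⟨ solve 4 (λ v g s q → v :* g :* (s :* q) := g :* (q :* v) :* s) refl
             (invFact (e ∸ m)) (G m) s (powℚ t (e ∸ m)) ⟩
      G m * (powℚ t (e ∸ m) * invFact (e ∸ m)) * s ∎

-- The Fine-Wilf theorem on a finite window

module FineWilf {c ℓ} (S : Setoid c ℓ) (f : ℕ → Setoid.Carrier S) (m : ℕ) where
  open Setoid S using (_≈_) renaming (refl to ≈-refl; sym to ≈-sym; trans to ≈-trans; reflexive to ≈-reflexive)
  open ≡ using (refl; sym; trans; cong; subst)
  open import Data.Nat using (_+_; _≤_; _<_; z≤n; s≤s)
  open import Data.Nat.Properties

  -- The window consists of the positions 0, …, len + p + m − 2; for periods a and b it has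
  -- length a + b + m − 1, and m is invariant under the subtractive Euclidean algorithm.
  Period : ℕ → ℕ → Set ℓ
  Period p len = ∀ i → suc i < len + m → f i ≈ f (i + p)

  -- The larger window has just a more positions, and one step back by the period a brings each of
  -- them into the smaller window.
  extend : ∀ a c → (∀ i → suc i < a + suc c + m → f i ≈ f 0) → Period a (suc (a + c)) →
    ∀ i → suc i < a + suc (a + c) + m → f i ≈ f 0
  extend a c small per i i< with suc i ℕ.<? a + suc c + m
  ... | yes p = small i p
  ... | no ¬p = ≈-trans (≈-trans (≈-reflexive (cong f (sym i≡))) (≈-sym (per (i ℕ.∸ a) j<)))
                  (small (i ℕ.∸ a) (subst (λ z → suc (i ℕ.∸ a) < z + m) (sym (+-suc a c)) j<))
    where
    a≤i : a ≤ i
    a≤i = ≤-pred (≤-trans (≤-trans (≤-reflexive (+-comm 1 a)) (≤-trans (+-monoʳ-≤ a (s≤s z≤n)) (m≤m+n (a + suc c) m))) (≮⇒≥ ¬p))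
    i≡ : i ℕ.∸ a + a ≡ i
    i≡ = m∸n+n≡m a≤i
    j< : suc (i ℕ.∸ a) < suc (a + c) + m
    j< = +-cancelʳ-< a _ _ (subst (λ z → suc z < _) (sym i≡)
      (<-≤-trans i< (≤-reflexive (trans (+-assoc a (suc (a + c)) m) (+-comm a _)))))

  Constant : ℕ → ℕ → Set ℓ
  Constant a b = 1 ≤ a → 1 ≤ b → Coprime a b → Period a b → Period b a →
    ∀ i → suc i < a + b + m → f i ≈ f 0

  -- A Euclidean step: a move forward by a + k + 1 followed by a move back by a is a move forward by
  -- k + 1, so k + 1 is a period too, on the window that belongs to the pair (a, k + 1).
  subtract : ∀ a k → Constant a (suc k) → Constant a (suc (a + k))
  subtract a k rec 1≤a _ cop pa pb = extend a k (rec 1≤a (s≤s z≤n) cop′ pa′ pk) pa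
    where
    cop′ : Coprime a (suc k)
    cop′ {d} (d∣a , d∣k) = cop (d∣a , subst (d ∣_) (+-suc a k) (∣m∣n⇒∣m+n d∣a d∣k))
    pa′ : Period a (suc k)
    pa′ i i< = pa i (<-≤-trans i< (+-monoˡ-≤ m (s≤s (m≤n+m k a))))
    pk : Period (suc k) a
    pk i i< = ≈-trans (pb i i<) (≈-trans (≈-reflexive (cong f
        (trans (cong (λ z → i + z) (trans (sym (+-suc a k)) (+-comm a (suc k)))) (sym (+-assoc i (suc k) a)))))
      (≈-sym (pa (i + suc k) (<-≤-trans (+-monoˡ-< (suc k) i<) (≤-reflexive
        (trans (+-assoc a m (suc k)) (trans (cong (λ z → a + z) (+-comm m (suc k)))
          (trans (sym (+-assoc a (suc k) m)) (cong (_+ m) (+-suc a k))))))))))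

  smaller : ∀ a k {fuel} → 1 ≤ a → a + suc (a + k) ≤ suc fuel → a + suc k ≤ fuel
  smaller a k 1≤a p = ≤-pred (≤-trans (≤-trans (+-monoˡ-≤ (a + suc k) 1≤a)
    (+-monoʳ-≤ a (≤-reflexive (+-suc a k)))) p)

  constant-fuel : ∀ fuel a b → a + b ≤ fuel → Constant a b
  constant-fuel zero       (suc a) b ()
  constant-fuel (suc fuel) a b a+b≤ 1≤a 1≤b cop pa pb with ℕ.compare a b
  ... | ℕ.less .a k = subtract a k (constant-fuel fuel a (suc k) (smaller a k 1≤a a+b≤)) 1≤a 1≤b cop pa pb
  ... | ℕ.greater .b k = λ i i< →
      subtract b k (constant-fuel fuel b (suc k) (smaller b k 1≤b (≤-trans (≤-reflexive (+-comm b _)) a+b≤))) 1≤b 1≤a (Coprimality.sym cop) pb pa i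
        (<-≤-trans i< (≤-reflexive (cong (_+ m) (+-comm (suc (b + k)) b))))
  -- Equal coprime numbers are 1, and period 1 links neighbouring positions.
  ... | ℕ.equal .a with cop (∣-refl , ∣-refl)
  ...   | refl = go
    where
    go : ∀ i → suc i < 2 + m → f i ≈ f 0
    go zero    _        = ≈-refl
    go (suc i) (s≤s i<) = ≈-trans (≈-trans (≈-reflexive (cong f (+-comm 1 i))) (≈-sym (pa i i<))) (go i (m<n⇒m<1+n i<))

  constant : ∀ a b → Constant a b
  constant a b = constant-fuel (a + b) a b ≤-refl

-- Integers and rationals in a field of characteristic zero

module OverField {c ℓ} (K : Char0Field c ℓ) where
  open Series
  open Char0Field K using (cring; _⁻¹; inverseʳ; char0)
  open CommutativeRing cring hiding (zero)
  open Algebra.Properties.Ring ring using (-0#≈0#; -‿+-comm; -‿distribˡ-*; -‿distribʳ-*; -‿involutive)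
  module Mult = Algebra.Properties.Semiring.Mult semiring
  open Relation.Binary.Reasoning.Setoid setoid

  nat : ℕ → Carrier
  nat = natR cring

  int : ℤ → Carrier
  int = intR cring

  nat≈×1 : ∀ n → nat n ≈ n Mult.× 1#
  nat≈×1 zero    = refl
  nat≈×1 (suc n) = +-congˡ (nat≈×1 n)

  nat-+ : ∀ m n → nat (m ℕ.+ n) ≈ nat m + nat n
  nat-+ m n = trans (nat≈×1 (m ℕ.+ n)) (trans (Mult.×-homo-+ 1# m n) (+-cong (sym (nat≈×1 m)) (sym (nat≈×1 n))))

  nat-* : ∀ m n → nat (m ℕ.* n) ≈ nat m * nat n
  nat-* m n = trans (nat≈×1 (m ℕ.* n)) (trans (Mult.×1-homo-* m n) (*-cong (sym (nat≈×1 m)) (sym (nat≈×1 n))))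

  int-neg : ∀ i → int (ℤ.- i) ≈ - int i
  int-neg (+ zero)   = sym -0#≈0#
  int-neg (+ suc n)  = refl
  int-neg -[1+ n ]   = sym (-‿involutive (nat (suc n)))

  int-⊖ : ∀ m n → int (m ℤ.⊖ n) ≈ nat m - nat n
  int-⊖ zero    zero    = sym (trans (+-congˡ -0#≈0#) (+-identityʳ _))
  int-⊖ zero    (suc n) = trans (int-neg (+ suc n)) (sym (+-identityˡ _))
  int-⊖ (suc m) zero    = sym (trans (+-congˡ -0#≈0#) (+-identityʳ _))
  int-⊖ (suc m) (suc n) = begin
    int (suc m ℤ.⊖ suc n)                  ≡⟨ ≡.cong int (ℤₚ.[1+m]⊖[1+n]≡m⊖n m n) ⟩
    int (m ℤ.⊖ n)                          ≈⟨ int-⊖ m n ⟩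
    nat m - nat n                          ≈⟨ +-congʳ (+-identityʳ _) ⟨
    (nat m + 0#) - nat n                   ≈⟨ +-congʳ (+-congˡ (-‿inverseʳ 1#)) ⟨
    (nat m + (1# - 1#)) - nat n            ≈⟨ +-congʳ (+-assoc _ _ _) ⟨
    ((nat m + 1#) - 1#) - nat n            ≈⟨ +-assoc _ _ _ ⟩
    (nat m + 1#) + (- 1# - nat n)          ≈⟨ +-cong (+-comm _ _) (-‿+-comm 1# (nat n)) ⟩
    nat (suc m) - nat (suc n)              ∎

  int-+ : ∀ i j → int (i ℤ.+ j) ≈ int i + int j
  int-+ (+ m)     (+ n)     = nat-+ m n
  int-+ (+ m)     -[1+ n ]  = int-⊖ m (suc n)
  int-+ -[1+ m ]  (+ n)     = trans (int-⊖ n (suc m)) (+-comm _ _)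
  int-+ -[1+ m ]  -[1+ n ]  = trans (-‿cong (trans (reflexive (≡.cong (λ z → nat (suc z)) (≡.sym (ℕₚ.+-suc m n)))) (nat-+ (suc m) (suc n))))
    (sym (-‿+-comm (nat (suc m)) (nat (suc n))))

  int-*ₙ : ∀ i n → int (i ℤ.* + n) ≈ int i * nat n
  int-*ₙ (+ m)    n = trans (reflexive (≡.cong int (≡.sym (ℤₚ.pos-* m n)))) (nat-* m n)
  int-*ₙ -[1+ m ] n = begin
    int (-[1+ m ] ℤ.* + n)        ≡⟨ ≡.cong int (ℤₚ.neg-distribˡ-* (+ suc m) (+ n)) ⟨
    int (ℤ.- (+ suc m ℤ.* + n))   ≈⟨ int-neg (+ suc m ℤ.* + n) ⟩
    - int (+ suc m ℤ.* + n)       ≈⟨ -‿cong (int-*ₙ (+ suc m) n) ⟩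
    - (nat (suc m) * nat n)       ≈⟨ -‿distribˡ-* _ _ ⟩
    - nat (suc m) * nat n         ∎

  int-* : ∀ i j → int (i ℤ.* j) ≈ int i * int j
  int-* i (+ n)    = int-*ₙ i n
  int-* i -[1+ n ] = begin
    int (i ℤ.* -[1+ n ])          ≡⟨ ≡.cong int (ℤₚ.neg-distribʳ-* i (+ suc n)) ⟨
    int (ℤ.- (i ℤ.* + suc n))     ≈⟨ int-neg (i ℤ.* + suc n) ⟩
    - int (i ℤ.* + suc n)         ≈⟨ -‿cong (int-*ₙ i (suc n)) ⟩
    - (int i * nat (suc n))       ≈⟨ -‿distribʳ-* _ _ ⟩
    int i * - nat (suc n)         ∎

  -- Sends 1 to 1# itself rather than to 1# + 0#, so that solver equations can mention 1#.
  coeff : ℤ → Carrier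
  coeff (+ 1) = 1#
  coeff i     = int i

  coeff≈int : ∀ i → coeff i ≈ int i
  coeff≈int (+ 0)           = refl
  coeff≈int (+ 1)           = sym (+-identityʳ 1#)
  coeff≈int (+ suc (suc n)) = refl
  coeff≈int -[1+ n ]        = refl

  coeff-morphism : ℤ.+-*-rawRing ACR.-Raw-AlmostCommutative⟶ ACR.fromCommutativeRing cring
  coeff-morphism = record
    { ⟦_⟧    = coeff
    ; +-homo = λ i j → trans (coeff≈int (i ℤ.+ j)) (trans (int-+ i j) (sym (+-cong (coeff≈int i) (coeff≈int j))))
    ; *-homo = λ i j → trans (coeff≈int (i ℤ.* j)) (trans (int-* i j) (sym (*-cong (coeff≈int i) (coeff≈int j))))
    ; -‿homo = λ i → trans (coeff≈int (ℤ.- i)) (trans (int-neg i) (sym (-‿cong (coeff≈int i))))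
    ; 0-homo = refl
    ; 1-homo = refl
    }

  coeff-≟ : WeaklyDecidable (ACR.Induced-equivalence coeff-morphism)
  coeff-≟ i j with i ℤ.≟ j
  ... | yes i≡j = just (reflexive (≡.cong coeff i≡j))
  ... | no  _   = nothing

  module Solver = Algebra.Solver.Ring ℤ.+-*-rawRing (ACR.fromCommutativeRing cring) coeff-morphism coeff-≟
  open Solver
    using (solve; _:=_; _:+_; _:*_; _:-_; :-_; con)

  1≉0 : ¬ 1# ≈ 0#
  1≉0 eq = char0 0 (trans (+-identityʳ 1#) eq)

  unit≉0 : ∀ {x y} → x * y ≈ 1# → ¬ x ≈ 0#
  unit≉0 xy≈1 x≈0 = 1≉0 (trans (sym xy≈1) (trans (*-congʳ x≈0) (zeroˡ _)))

  *-cancelʳ : ∀ {z} → ¬ z ≈ 0# → ∀ {x y} → x * z ≈ y * z → x ≈ y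
  *-cancelʳ {z} z≉0 {x} {y} eq = begin
    x                ≈⟨ expand x ⟩
    x * z * z ⁻¹     ≈⟨ *-congʳ eq ⟩
    y * z * z ⁻¹     ≈⟨ expand y ⟨
    y                ∎
    where
    expand : ∀ w → w ≈ w * z * z ⁻¹
    expand w = sym (trans (*-assoc _ _ _) (trans (*-congˡ (inverseʳ z z≉0)) (*-identityʳ w)))

  ⁻¹-unique : ∀ {x y} → x * y ≈ 1# → y ≈ x ⁻¹
  ⁻¹-unique {x} xy≈1 = *-cancelʳ (unit≉0 xy≈1)
    (trans (*-comm _ x) (trans xy≈1 (sym (trans (*-comm _ x) (inverseʳ x (unit≉0 xy≈1))))))

  *-≉0 : ∀ {x y} → ¬ x ≈ 0# → ¬ y ≈ 0# → ¬ x * y ≈ 0#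
  *-≉0 x≉0 y≉0 xy≈0 = x≉0 (*-cancelʳ y≉0 (trans xy≈0 (sym (zeroˡ _))))

  ⁻¹-* : ∀ {x y} → ¬ x ≈ 0# → ¬ y ≈ 0# → (x * y) ⁻¹ ≈ x ⁻¹ * y ⁻¹
  ⁻¹-* {x} {y} x≉0 y≉0 = sym (⁻¹-unique (begin
    x * y * (x ⁻¹ * y ⁻¹)      ≈⟨ solve 4 (λ x y u v → x :* y :* (u :* v) := x :* u :* (y :* v)) refl x y (x ⁻¹) (y ⁻¹) ⟩
    x * x ⁻¹ * (y * y ⁻¹)      ≈⟨ *-cong (inverseʳ x x≉0) (inverseʳ y y≉0) ⟩
    1# * 1#                    ≈⟨ *-identityʳ 1# ⟩
    1#                         ∎))

  nat≉0 : ∀ n → 1 ℕ.≤ n → ¬ nat n ≈ 0#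
  nat≉0 (suc n) _ = char0 n

  ratK-* : ∀ q → ratK K q * nat (ℚ.denominatorℕ q) ≈ int (ℚ.numerator q)
  ratK-* q@(mkℚ _ d _) = trans (*-assoc _ _ _)
    (trans (*-congˡ (trans (*-comm _ _) (inverseʳ _ (char0 d)))) (*-identityʳ _))

  -- The sum of rationals is normalised, so its numerator and denominator are known only through a
  -- cross-multiplied identity; multiplying by all three denominators makes that identity
  -- applicable.
  ratK-+ : ∀ p q → ratK K (p ℚ.+ q) ≈ ratK K p + ratK K q
  ratK-+ p@(mkℚ np dp _) q@(mkℚ nq dq _) = *-cancelʳ (*-≉0 (*-≉0 (den≉0 s) (char0 dp)) (char0 dq)) (begin
    ratK K s * (D * P * Q)
      ≈⟨ solve 4 (λ r D P Q → r :* (D :* P :* Q) := r :* D :* (P :* Q)) refl _ D P Q ⟩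
    ratK K s * D * (P * Q)
      ≈⟨ *-congʳ (ratK-* s) ⟩
    int (ℚ.numerator s) * (P * Q)
      ≈⟨ *-congˡ (nat-* (suc dp) (suc dq)) ⟨
    int (ℚ.numerator s) * nat (suc dp ℕ.* suc dq)
      ≈⟨ int-* (ℚ.numerator s) (+ (suc dp ℕ.* suc dq)) ⟨
    int (ℚ.numerator s ℤ.* + (suc dp ℕ.* suc dq))
      ≡⟨ ≡.cong int (cross s (ℚₚ.toℚᵘ-homo-+ p q)) ⟩
    int ((np ℤ.* + suc dq ℤ.+ nq ℤ.* + suc dp) ℤ.* + ℚ.denominatorℕ s)
      ≈⟨ trans (int-* (np ℤ.* + suc dq ℤ.+ nq ℤ.* + suc dp) (+ ℚ.denominatorℕ s))
           (*-congʳ (trans (int-+ (np ℤ.* + suc dq) (nq ℤ.* + suc dp)) (+-cong (int-* np (+ suc dq)) (int-* nq (+ suc dp))))) ⟩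
    (int np * Q + int nq * P) * D
      ≈⟨ *-congʳ (+-cong (*-congʳ (ratK-* p)) (*-congʳ (ratK-* q))) ⟨
    (ratK K p * P * Q + ratK K q * Q * P) * D
      ≈⟨ solve 5 (λ a b D P Q → (a :* P :* Q :+ b :* Q :* P) :* D := (a :+ b) :* (D :* P :* Q)) refl (ratK K p) (ratK K q) D P Q ⟩
    (ratK K p + ratK K q) * (D * P * Q) ∎)
    where
    s = p ℚ.+ q
    D = nat (ℚ.denominatorℕ s)
    P = nat (suc dp)
    Q = nat (suc dq)
    den≉0 : ∀ s → ¬ nat (ℚ.denominatorℕ s) ≈ 0#
    den≉0 (mkℚ _ d _) = char0 d
    cross : ∀ s → ℚ.toℚᵘ s ℚᵘ.≃ ℚ.toℚᵘ p ℚᵘ.+ ℚ.toℚᵘ q →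
      ℚ.numerator s ℤ.* + (suc dp ℕ.* suc dq) ≡ (np ℤ.* + suc dq ℤ.+ nq ℤ.* + suc dp) ℤ.* + ℚ.denominatorℕ s
    cross (mkℚ _ _ _) (ℚᵘ.*≡* eq) = eq

  ratK-0 : ratK K ℚ.0ℚ ≈ 0#
  ratK-0 = zeroˡ _

  ratK-neg : ∀ q → ratK K (ℚ.- q) ≈ - ratK K q
  ratK-neg q = begin
    ratK K (ℚ.- q)                              ≈⟨ solve 2 (λ a b → a := (a :+ b) :- b) refl _ (ratK K q) ⟩
    (ratK K (ℚ.- q) + ratK K q) - ratK K q      ≈⟨ +-congʳ (ratK-+ (ℚ.- q) q) ⟨
    ratK K (ℚ.- q ℚ.+ q) - ratK K q             ≈⟨ +-congʳ (trans (reflexive (≡.cong (ratK K) (ℚₚ.+-inverseˡ q))) ratK-0) ⟩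
    0# - ratK K q                               ≈⟨ +-identityˡ _ ⟩
    - ratK K q                                  ∎

  ratK-invℕ : ∀ a → 1 ℕ.≤ a → ratK K (invℕ a) ≈ nat a ⁻¹
  ratK-invℕ (suc a) _ = ⁻¹-unique (trans (*-comm _ _) (cross (invℕ (suc a)) (ℚₚ.toℚᵘ-fromℚᵘ (ℚᵘ.mkℚᵘ (+ 1) a))))
    where
    cross : ∀ q → ℚ.toℚᵘ q ℚᵘ.≃ ℚᵘ.mkℚᵘ (+ 1) a → ratK K q * nat (suc a) ≈ 1#
    cross q@(mkℚ n d _) (ℚᵘ.*≡* eq) = *-cancelʳ (char0 d) (begin
      ratK K q * nat (suc a) * nat (suc d)     ≈⟨ solve 3 (λ r a d → r :* a :* d := r :* d :* a) refl (ratK K q) (nat (suc a)) (nat (suc d)) ⟩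
      ratK K q * nat (suc d) * nat (suc a)     ≈⟨ *-congʳ (ratK-* q) ⟩
      int n * nat (suc a)                      ≈⟨ int-* n (+ suc a) ⟨
      int (n ℤ.* + suc a)                      ≡⟨ ≡.cong int eq ⟩
      int (+ 1 ℤ.* + suc d)                    ≡⟨ ≡.cong int (ℤₚ.*-identityˡ (+ suc d)) ⟩
      nat (suc d)                              ≈⟨ *-identityˡ _ ⟨
      1# * nat (suc d)                         ∎)

  -- Finite sums, powers and the geometric series

  sumTo : (ℕ → Carrier) → ℕ → Carrier
  sumTo f zero    = 0#
  sumTo f (suc j) = sumTo f j + f (suc j)

  -- The wildcard stands for the local function of sumFrom1, as in bernTable-suc.
  mutual
    sumFrom1≡sumTo : ∀ b f → sumFrom1 K b f ≡ sumTo f (b ∸ 1)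
    go≡sumTo : ∀ b f k → _ ≡ sumTo f k

    sumFrom1≡sumTo b f with b ∸ 1
    ... | k = go≡sumTo b f k

    go≡sumTo b f zero    = ≡.refl
    go≡sumTo b f (suc k) = ≡.cong (_+ f (suc k)) (go≡sumTo b f k)

  infixl 9 _^_
  _^_ : Carrier → ℕ → Carrier
  _^_ = pow K

  ^-cong : ∀ {x y} k → x ≈ y → x ^ k ≈ y ^ k
  ^-cong zero    eq = refl
  ^-cong (suc k) eq = *-cong eq (^-cong k eq)

  ^-+ : ∀ x m n → x ^ (m ℕ.+ n) ≈ x ^ m * x ^ n
  ^-+ x zero    n = sym (*-identityˡ _)
  ^-+ x (suc m) n = trans (*-congˡ (^-+ x m n)) (sym (*-assoc _ _ _))

  1^ : ∀ k → 1# ^ k ≈ 1#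
  1^ zero    = refl
  1^ (suc k) = trans (*-identityˡ _) (1^ k)

  ^-* : ∀ x m n → x ^ (m ℕ.* n) ≈ (x ^ n) ^ m
  ^-* x zero    n = refl
  ^-* x (suc m) n = trans (^-+ x n (m ℕ.* n)) (*-congˡ (^-* x m n))

  ^-≉0 : ∀ {x} → ¬ x ≈ 0# → ∀ k → ¬ x ^ k ≈ 0#
  ^-≉0 x≉0 zero    = 1≉0
  ^-≉0 x≉0 (suc k) = *-≉0 x≉0 (^-≉0 x≉0 k)

  zpow-1 : ∀ {x} → ¬ x ≈ 0# → ∀ i → zpow K x (i ℤ.+ + 1) ≈ zpow K x i * x
  zpow-1 {x} x≉0 (+ k)          = begin
    x ^ (k ℕ.+ 1)       ≡⟨ ≡.cong (x ^_) (ℕₚ.+-comm k 1) ⟩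
    x * x ^ k           ≈⟨ *-comm _ _ ⟩
    x ^ k * x           ∎
  zpow-1 {x} x≉0 -[1+ zero ]    = begin
    1#                  ≈⟨ inverseʳ _ (^-≉0 x≉0 1) ⟨
    x ^ 1 * (x ^ 1) ⁻¹  ≈⟨ *-comm _ _ ⟩
    (x ^ 1) ⁻¹ * x ^ 1  ≈⟨ *-congˡ (*-identityʳ x) ⟩
    (x ^ 1) ⁻¹ * x      ∎
  zpow-1 {x} x≉0 -[1+ suc k ]   = begin
    (x ^ suc k) ⁻¹                    ≈⟨ *-identityˡ _ ⟨
    1# * (x ^ suc k) ⁻¹               ≈⟨ *-congʳ (inverseʳ x x≉0) ⟨
    x * x ⁻¹ * (x ^ suc k) ⁻¹         ≈⟨ *-assoc _ _ _ ⟩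
    x * (x ⁻¹ * (x ^ suc k) ⁻¹)       ≈⟨ *-congˡ (⁻¹-* x≉0 (^-≉0 x≉0 (suc k))) ⟨
    x * (x * x ^ suc k) ⁻¹            ≈⟨ *-comm _ _ ⟩
    (x * x ^ suc k) ⁻¹ * x            ∎

  zpow-+ : ∀ {x} → ¬ x ≈ 0# → ∀ i k → zpow K x (i ℤ.+ + k) ≈ zpow K x i * x ^ k
  zpow-+ {x} x≉0 i zero    = trans (reflexive (≡.cong (zpow K x) (ℤₚ.+-identityʳ i))) (sym (*-identityʳ _))
  zpow-+ {x} x≉0 i (suc k) = begin
    zpow K x (i ℤ.+ + suc k)           ≡⟨ ≡.cong (zpow K x) (ℤₚ.+-assoc i (+ 1) (+ k)) ⟨
    zpow K x (i ℤ.+ + 1 ℤ.+ + k)       ≈⟨ zpow-+ x≉0 (i ℤ.+ + 1) k ⟩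
    zpow K x (i ℤ.+ + 1) * x ^ k       ≈⟨ *-congʳ (zpow-1 x≉0 i) ⟩
    zpow K x i * x * x ^ k             ≈⟨ *-assoc _ _ _ ⟩
    zpow K x i * x ^ suc k             ∎

  sumTo-cong : ∀ m {f g : ℕ → Carrier} → (∀ j → 1 ℕ.≤ j → j ℕ.≤ m → f j ≈ g j) → sumTo f m ≈ sumTo g m
  sumTo-cong zero    p = refl
  sumTo-cong (suc m) p = +-cong (sumTo-cong m (λ j 1≤j j≤m → p j 1≤j (ℕₚ.m≤n⇒m≤1+n j≤m))) (p (suc m) (ℕ.s≤s ℕ.z≤n) ℕₚ.≤-refl)

  sumTo-+ : ∀ m (f g : ℕ → Carrier) → sumTo (λ j → f j + g j) m ≈ sumTo f m + sumTo g m
  sumTo-+ zero    f g = sym (+-identityˡ _)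
  sumTo-+ (suc m) f g = trans (+-congʳ (sumTo-+ m f g))
    (solve 4 (λ a b x y → (a :+ b) :+ (x :+ y) := (a :+ x) :+ (b :+ y)) refl _ _ _ _)

  geometric : ∀ y m → (y - 1#) * (1# + sumTo (y ^_) m) ≈ y ^ suc m - 1#
  geometric y zero    = solve 1 (λ y → (y :- con (+ 1)) :* (con (+ 1) :+ con (+ 0)) := y :* con (+ 1) :- con (+ 1)) refl y
  geometric y (suc m) = trans
    (solve 3 (λ y s p → (y :- con (+ 1)) :* (con (+ 1) :+ (s :+ p)) := (y :- con (+ 1)) :* (con (+ 1) :+ s) :+ (y :- con (+ 1)) :* p) refl y _ (y ^ suc m))
    (trans (+-congʳ (geometric y m))
      (solve 2 (λ y p → (p :- con (+ 1)) :+ (y :- con (+ 1)) :* p := y :* p :- con (+ 1)) refl y (y ^ suc m)))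

  -- Primitive roots of unity

  Entry : Set c
  Entry = ℕ × Carrier

  Primitive : Entry → Set ℓ
  Primitive (a , ζ) = 1 ℕ.≤ a × IsPrimitiveRoot K a ζ

  primitive-≉0 : ∀ {a ζ} → Primitive (a , ζ) → ¬ ζ ≈ 0#
  primitive-≉0 {suc a} (_ , ζᵃ≈1 , _) = unit≉0 ζᵃ≈1

  -- The remainder of m modulo a is an exponent below a at which ζ also takes the value 1, so
  -- minimality makes it 0.
  order-∣ : ∀ {a ζ} → Primitive (a , ζ) → ∀ m → ζ ^ m ≈ 1# → a ∣ m
  order-∣ {a@(suc _)} {ζ} (_ , ζᵃ≈1 , prim) m ζᵐ≈1 = m%n≡0⇒n∣m m a (remainder (m ℕ.% a) (ℕ.m%n<n m a) ζʳ≈1)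
    where
    remainder : ∀ r → r ℕ.< a → ζ ^ r ≈ 1# → r ≡ 0
    remainder zero    _   _  = ≡.refl
    remainder (suc r) r<a eq = contradiction eq (prim (suc r) (ℕ.s≤s ℕ.z≤n) r<a)
    ζʳ≈1 : ζ ^ (m ℕ.% a) ≈ 1#
    ζʳ≈1 = begin
      ζ ^ (m ℕ.% a)                                ≈⟨ *-identityʳ _ ⟨
      ζ ^ (m ℕ.% a) * 1#                           ≈⟨ *-congˡ (trans (^-cong (m ℕ./ a) ζᵃ≈1) (1^ (m ℕ./ a))) ⟨
      ζ ^ (m ℕ.% a) * (ζ ^ a) ^ (m ℕ./ a)          ≈⟨ *-congˡ (^-* ζ (m ℕ./ a) a) ⟨
      ζ ^ (m ℕ.% a) * ζ ^ (m ℕ./ a ℕ.* a)          ≈⟨ ^-+ ζ (m ℕ.% a) _ ⟨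
      ζ ^ (m ℕ.% a ℕ.+ m ℕ./ a ℕ.* a)              ≡⟨ ≡.cong (ζ ^_) (ℕ.m≡m%n+[m/n]*n m a) ⟨
      ζ ^ m                                        ≈⟨ ζᵐ≈1 ⟩
      1#                                           ∎

  -- Says that 1 - η^(j a) is invertible for all j in the range of summation modulo b.
  Separated : ℕ → Entry → Set ℓ
  Separated a (b , η) = ∀ j → 1 ℕ.≤ j → j ℕ.≤ b ∸ 1 → ¬ η ^ (j ℕ.* a) ≈ 1#

  -- If η^(j a) = 1 then the order of η divides j a, hence j by coprimality, although j is positive
  -- and smaller than the order.
  coprime⇒separated : ∀ {a b η} → Coprime a b → Primitive (b , η) → Separated a (b , η)
  coprime⇒separated {a} {suc b} cop prim j@(suc _) _ j≤b eq =
    ℕₚ.<-irrefl ≡.refl (ℕₚ.≤-trans (∣⇒≤ (coprime-divisor (Coprimality.sym cop) b∣aj)) j≤b)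
    where b∣aj = ≡.subst (suc b ∣_) (ℕₚ.*-comm j a) (order-∣ prim (j ℕ.* a) eq)

  -- Weighted Fourier-Dedekind sums and their difference equation

  fac : ℕ → Carrier → ℕ → Carrier
  fac a ζ j = (1# - ζ ^ (j ℕ.* a)) ⁻¹

  1-≉0 : ∀ {x} → ¬ x ≈ 1# → ¬ 1# - x ≈ 0#
  1-≉0 {x} x≉1 eq = x≉1 (begin
    x                  ≈⟨ solve 1 (λ x → x := con (+ 1) :- (con (+ 1) :- x)) refl x ⟩
    1# - (1# - x)      ≈⟨ +-congˡ (-‿cong eq) ⟩
    1# - 0#            ≈⟨ solve 0 (con (+ 1) :- con (+ 0) := con (+ 1)) refl ⟩
    1#                 ∎)

  facs : List ℕ → Carrier → ℕ → Carrier
  facs []       ζ j = 1#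
  facs (a ∷ as) ζ j = fac a ζ j * facs as ζ j

  facs-↭ : ∀ {as bs} → as ↭ bs → ∀ ζ j → facs as ζ j ≈ facs bs ζ j
  facs-↭ Perm.refl        ζ j = refl
  facs-↭ (prep a p)       ζ j = *-congˡ (facs-↭ p ζ j)
  facs-↭ (swap a b p)     ζ j = trans (*-congˡ (*-congˡ (facs-↭ p ζ j)))
    (solve 3 (λ x y z → x :* (y :* z) := y :* (x :* z)) refl _ _ _)
  facs-↭ (Perm.trans p q) ζ j = trans (facs-↭ p ζ j) (facs-↭ q ζ j)

  Weight : Set c
  Weight = Carrier → ℕ → Carrier

  infix 4 _≋_
  _≋_ : Weight → Weight → Set _
  g ≋ h = ∀ ζ j → g ζ j ≈ h ζ j

  infixl 7 _⊙_
  _⊙_ : Weight → Weight → Weight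
  (g ⊙ h) ζ j = g ζ j * h ζ j

  term : Weight → Entry → List ℕ → ℤ → Carrier
  term g (a , ζ) cs n = nat a ⁻¹ * sumTo (λ j → zpow K ζ (+ j ℤ.* n) * (g ζ j * facs cs ζ j)) (a ∸ 1)

  -- Weights collect the factors of the entries already passed, so that reordering
  -- and removing entries can be treated by recursion on the list.
  T : Weight → List Entry → ℤ → Carrier
  T g []            n = 0#
  T g ((a , ζ) ∷ L) n = term g (a , ζ) (map proj₁ L) n + T (g ⊙ fac a) L n

  term-cong : ∀ g h e cs ds n → (∀ ζ j → g ζ j * facs cs ζ j ≈ h ζ j * facs ds ζ j) → term g e cs n ≈ term h e ds n
  term-cong g h (a , ζ) cs ds n eq = *-congˡ (sumTo-cong (a ∸ 1) (λ j _ _ → *-congˡ (eq ζ j)))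

  T-cong : ∀ {g h} L n → g ≋ h → T g L n ≈ T h L n
  T-cong []            n eq = refl
  T-cong {g} {h} ((a , ζ) ∷ L) n eq = +-cong (term-cong g h (a , ζ) (map proj₁ L) (map proj₁ L) n (λ ζ j → *-congʳ (eq ζ j))) (T-cong L n (λ ζ j → *-congʳ (eq ζ j)))

  -- When two heads are swapped, the factor that each contributes to the other's term moves between
  -- the weight and the list of sizes; the total product of factors is unchanged.
  T-↭ : ∀ {L M} → L ↭ M → ∀ g n → T g L n ≈ T g M n
  T-↭ Perm.refl            g n = refl
  T-↭ (prep {L} {M} (a , ζ) p)     g n = +-cong (term-cong g g (a , ζ) (map proj₁ L) (map proj₁ M) n (λ ζ j → *-congˡ (facs-↭ (Permₚ.map⁺ proj₁ p) ζ j))) (T-↭ p (g ⊙ fac a) n)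
  T-↭ (swap {L} {M} (a , ζ) (b , η) p) g n = begin
    term g (a , ζ) (b ∷ as) n + (term (g ⊙ fac a) (b , η) as n + T (g ⊙ fac a ⊙ fac b) L n)
      ≈⟨ solve 3 (λ x y z → x :+ (y :+ z) := y :+ (x :+ z)) refl _ _ _ ⟩
    term (g ⊙ fac a) (b , η) as n + (term g (a , ζ) (b ∷ as) n + T (g ⊙ fac a ⊙ fac b) L n)
      ≈⟨ +-cong (term-cong (g ⊙ fac a) g (b , η) as (a ∷ bs) n (λ ζ j → trans (*-assoc _ _ _) (*-congˡ (*-congˡ (perm ζ j)))))
           (+-cong (term-cong g (g ⊙ fac b) (a , ζ) (b ∷ as) bs n (λ ζ j → trans (sym (*-assoc _ _ _)) (*-congˡ (perm ζ j))))
             (trans (T-cong L n (λ ζ j → solve 3 (λ g x y → g :* x :* y := g :* y :* x) refl _ _ _)) (T-↭ p (g ⊙ fac b ⊙ fac a) n))) ⟩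
    term g (b , η) (a ∷ bs) n + (term (g ⊙ fac b) (a , ζ) bs n + T (g ⊙ fac b ⊙ fac a) M n) ∎
    where
    as = map proj₁ L
    bs = map proj₁ M
    perm = facs-↭ (Permₚ.map⁺ proj₁ p)
  T-↭ (Perm.trans p q)     g n = trans (T-↭ p g n) (T-↭ q g n)

  zpow-shift : ∀ {ζ} → ¬ ζ ≈ 0# → ∀ j n a → zpow K ζ (+ j ℤ.* (n ℤ.+ + a)) ≈ zpow K ζ (+ j ℤ.* n) * ζ ^ (j ℕ.* a)
  zpow-shift {ζ} ζ≉0 j n a = trans (reflexive (≡.cong (zpow K ζ)
    (≡.trans (ℤₚ.*-distribˡ-+ (+ j) n (+ a)) (≡.cong (λ z → + j ℤ.* n ℤ.+ z) (≡.sym (ℤₚ.pos-* j a))))))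
    (zpow-+ ζ≉0 (+ j ℤ.* n) (j ℕ.* a))

  term-periodic : ∀ g a ζ cs n → Primitive (a , ζ) → term g (a , ζ) cs n ≈ term g (a , ζ) cs (n ℤ.+ + a)
  term-periodic g a ζ cs n prim@(_ , ζᵃ≈1 , _) = *-congˡ (sumTo-cong (a ∸ 1) (λ j _ _ → *-congʳ (sym (begin
    zpow K ζ (+ j ℤ.* (n ℤ.+ + a))          ≈⟨ zpow-shift (primitive-≉0 prim) j n a ⟩
    zpow K ζ (+ j ℤ.* n) * ζ ^ (j ℕ.* a)    ≈⟨ *-congˡ (trans (^-* ζ j a) (trans (^-cong j ζᵃ≈1) (1^ j))) ⟩
    zpow K ζ (+ j ℤ.* n) * 1#               ≈⟨ *-identityʳ _ ⟩
    zpow K ζ (+ j ℤ.* n)                    ∎))))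

  term-diff : ∀ g a b η cs n → Primitive (b , η) → Separated a (b , η) →
    term (g ⊙ fac a) (b , η) cs n ≈ term (g ⊙ fac a) (b , η) cs (n ℤ.+ + a) + term g (b , η) cs n
  term-diff g a b η cs n prim sep = trans
    (*-congˡ (trans (sumTo-cong (b ∸ 1) pointwise) (sumTo-+ (b ∸ 1) _ _)))
    (distribˡ _ _ _)
    where
    pointwise : ∀ j → 1 ℕ.≤ j → j ℕ.≤ b ∸ 1 →
      zpow K η (+ j ℤ.* n) * (g η j * fac a η j * facs cs η j)
      ≈ zpow K η (+ j ℤ.* (n ℤ.+ + a)) * (g η j * fac a η j * facs cs η j) + zpow K η (+ j ℤ.* n) * (g η j * facs cs η j)
    pointwise j 1≤j j≤ = begin
      -- Split 1 as y + (1 - y): the first part advances n by a, and the second cancels the factor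
      -- `u`.
      z * (w * u * v)
        ≈⟨ solve 5 (λ z w u v y → z :* (w :* u :* v) := z :* y :* (w :* u :* v) :+ z :* (w :* v) :* ((con (+ 1) :- y) :* u)) refl z w u v y ⟩
      z * y * (w * u * v) + z * (w * v) * ((1# - y) * u)
        ≈⟨ +-cong (*-congʳ (sym (zpow-shift (primitive-≉0 prim) j n a)))
             (trans (*-congˡ (inverseʳ _ (1-≉0 (sep j 1≤j j≤)))) (*-identityʳ _)) ⟩
      zpow K η (+ j ℤ.* (n ℤ.+ + a)) * (w * u * v) + z * (w * v) ∎
      where
      z = zpow K η (+ j ℤ.* n)
      y = η ^ (j ℕ.* a)
      w = g η j
      u = fac a η j
      v = facs cs η j

  T-diff-tail : ∀ a L g n → All Primitive L → All (Separated a) L →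
    T (g ⊙ fac a) L n ≈ T (g ⊙ fac a) L (n ℤ.+ + a) + T g L n
  T-diff-tail a []            g n _          _          = sym (+-identityʳ 0#)
  T-diff-tail a ((b , η) ∷ L) g n (pb ∷ pL) (sb ∷ sL) = begin
    term (g ⊙ fac a) (b , η) cs n + T (g ⊙ fac a ⊙ fac b) L n
      ≈⟨ +-cong (term-diff g a b η cs n pb sb)
           (trans (T-cong L n swapped) (trans (T-diff-tail a L (g ⊙ fac b) n pL sL)
             (+-congʳ (T-cong L (n ℤ.+ + a) (λ ζ j → sym (swapped ζ j)))))) ⟩
    (term (g ⊙ fac a) (b , η) cs (n ℤ.+ + a) + term g (b , η) cs n)
      + (T (g ⊙ fac a ⊙ fac b) L (n ℤ.+ + a) + T (g ⊙ fac b) L n)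
      ≈⟨ solve 4 (λ x y z w → (x :+ y) :+ (z :+ w) := (x :+ z) :+ (y :+ w)) refl _ _ _ _ ⟩
    (term (g ⊙ fac a) (b , η) cs (n ℤ.+ + a) + T (g ⊙ fac a ⊙ fac b) L (n ℤ.+ + a))
      + (term g (b , η) cs n + T (g ⊙ fac b) L n) ∎
    where
    cs = map proj₁ L
    swapped : g ⊙ fac a ⊙ fac b ≋ g ⊙ fac b ⊙ fac a
    swapped ζ j = solve 3 (λ g x y → g :* x :* y := g :* y :* x) refl _ _ _

  -- The new entry's own term has period a and drops out of the difference; every other term loses
  -- its factor for a.
  T-diff : ∀ a ζ L g n → Primitive (a , ζ) → All Primitive L → All (Separated a) L →
    T g ((a , ζ) ∷ L) n ≈ T g ((a , ζ) ∷ L) (n ℤ.+ + a) + T g L n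
  T-diff a ζ L g n pa pL sL = trans
    (+-cong (term-periodic g a ζ (map proj₁ L) n pa) (T-diff-tail a L g n pL sL)) (sym (+-assoc _ _ _))

  unit : Weight
  unit ζ j = 1#

  -- For y = ζ^m, an a-th root of 1 other than 1, the full geometric sum is 0, so the sum without
  -- the term j = 0 is -1.
  T-single : ∀ a ζ m → Primitive (a , ζ) → 1 ℕ.≤ m → m ℕ.< a → T unit ((a , ζ) ∷ []) (+ m) ≈ - nat a ⁻¹
  T-single a@(suc b) ζ m (_ , ζᵃ≈1 , prim) 1≤m m<a = begin
    nat a ⁻¹ * sumTo _ b + 0#
      ≈⟨ trans (+-identityʳ _) (*-congˡ (sumTo-cong b (λ j _ _ → trans (*-congˡ (*-identityʳ 1#)) (trans (*-identityʳ _)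
           (trans (reflexive (≡.cong (zpow K ζ) (≡.sym (ℤₚ.pos-* j m)))) (^-* ζ j m)))))) ⟩
    nat a ⁻¹ * sumTo (y ^_) b
      ≈⟨ *-congˡ (solve 1 (λ s → s := (con (+ 1) :+ s) :- con (+ 1)) refl _) ⟩
    nat a ⁻¹ * ((1# + sumTo (y ^_) b) - 1#)
      ≈⟨ *-congˡ (+-congʳ sum≈0) ⟩
    nat a ⁻¹ * (0# - 1#)
      ≈⟨ solve 1 (λ i → i :* (con (+ 0) :- con (+ 1)) := :- i) refl _ ⟩
    - nat a ⁻¹ ∎
    where
    y = ζ ^ m
    y-1≉0 : ¬ y - 1# ≈ 0#
    y-1≉0 eq = prim m 1≤m m<a (trans (solve 1 (λ y → y := (y :- con (+ 1)) :+ con (+ 1)) refl y) (trans (+-congʳ eq) (+-identityˡ 1#)))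
    yᵃ≈1 : y ^ a ≈ 1#
    yᵃ≈1 = begin
      y ^ a              ≈⟨ ^-* ζ a m ⟨
      ζ ^ (a ℕ.* m)      ≡⟨ ≡.cong (ζ ^_) (ℕₚ.*-comm a m) ⟩
      ζ ^ (m ℕ.* a)      ≈⟨ ^-* ζ m a ⟩
      (ζ ^ a) ^ m        ≈⟨ trans (^-cong m ζᵃ≈1) (1^ m) ⟩
      1#                 ∎
    sum≈0 : 1# + sumTo (y ^_) b ≈ 0#
    sum≈0 = *-cancelʳ y-1≉0 (begin
      (1# + sumTo (y ^_) b) * (y - 1#)   ≈⟨ *-comm _ _ ⟩
      (y - 1#) * (1# + sumTo (y ^_) b)   ≈⟨ geometric y b ⟩
      y ^ a - 1#                           ≈⟨ +-congʳ yᵃ≈1 ⟩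
      1# - 1#                              ≈⟨ -‿inverseʳ 1# ⟩
      0#                                   ≈⟨ zeroˡ _ ⟨
      0# * (y - 1#)                        ∎)

  T-ones : ∀ d g n → T g (replicate d (1 , 1#)) n ≈ 0#
  T-ones zero    g n = refl
  T-ones (suc d) g n = trans (+-cong (zeroʳ _) (T-ones d (g ⊙ fac 1) n)) (+-identityʳ 0#)

  -- Valid lists and the quantity `Q`

  trivial : Entry
  trivial = 1 , 1#

  CoprimeEntries : Entry → Entry → Set
  CoprimeEntries x y = Coprime (proj₁ x) (proj₁ y)

  Valid : List Entry → Set _
  Valid L = All Primitive L × AllPairs CoprimeEntries L

  Valid-↭ : ∀ {L M} → L ↭ M → Valid L → Valid M
  Valid-↭ p (prims , cops) = Permₚ.All-resp-↭ p prims ,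
    PermSetoidₚ.AllPairs-resp-↭ (≡.setoid Entry) Coprimality.sym (≡.resp₂ CoprimeEntries) (Perm.↭⇒↭ₛ p) cops

  Valid-tail : ∀ {x L} → Valid (x ∷ L) → Valid L
  Valid-tail (_ ∷ prims , _ ∷ cops) = prims , cops

  Valid-one : ∀ {L} → Valid L → Valid (trivial ∷ L)
  Valid-one (prims , cops) =
    (ℕ.s≤s ℕ.z≤n , *-identityʳ 1# , λ k 1≤k k<1 → contradiction (ℕₚ.≤-trans k<1 1≤k) (ℕₚ.<-irrefl ≡.refl)) ∷ prims ,
    All.universal {P = CoprimeEntries trivial} (λ y → Coprimality.1-coprimeTo (proj₁ y)) _ ∷ cops

  sizes : List Entry → List ℕ
  sizes = map proj₁

  total : List Entry → ℕ
  total L = sum (sizes L)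

  Q : List Entry → ℤ → Carrier
  Q L n = T unit L n + ratK K (polyNeg (sizes L) n)

  Q-↭ : ∀ {L M} → L ↭ M → ∀ n → Q L n ≈ Q M n
  Q-↭ p n = +-cong (T-↭ p unit n) (reflexive (≡.cong (ratK K) (polyNeg-↭ (Permₚ.map⁺ proj₁ p) n)))

  product-positive : ∀ {L} → All Primitive L → 1 ℕ.≤ product (sizes L)
  product-positive []               = ℕ.s≤s ℕ.z≤n
  product-positive ((1≤a , _) ∷ ps) = ℕₚ.*-mono-≤ 1≤a (product-positive ps)

  Q-diff : ∀ {a ζ L} → Valid ((a , ζ) ∷ L) → ∀ n → Q ((a , ζ) ∷ L) n ≈ Q ((a , ζ) ∷ L) (n ℤ.+ + a) + Q L n
  Q-diff {a} {ζ} {L} (pa ∷ pL , ca ∷ cL) n = begin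
    Q (x ∷ L) n
      ≈⟨ +-cong (T-diff a ζ L unit n pa pL separated)
           (trans (reflexive (≡.cong (ratK K) (polyNeg-diff a (sizes L) n (proj₁ pa) (product-positive pL))))
             (ratK-+ (polyNeg (sizes (x ∷ L)) (n ℤ.+ + a)) (polyNeg (sizes L) n))) ⟩
    (T unit (x ∷ L) (n ℤ.+ + a) + T unit L n) + (ratK K (polyNeg (sizes (x ∷ L)) (n ℤ.+ + a)) + ratK K (polyNeg (sizes L) n))
      ≈⟨ solve 4 (λ x y z w → (x :+ y) :+ (z :+ w) := (x :+ z) :+ (y :+ w)) refl _ _ _ _ ⟩
    Q (x ∷ L) (n ℤ.+ + a) + Q L n ∎
    where
    x = a , ζ
    separated : All (Separated a) L
    separated = All.zipWith {P = CoprimeEntries x} (λ (cop , prim) → coprime⇒separated cop prim) (ca , pL)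

  Q-[] : ∀ n → Q [] n ≈ 0#
  Q-[] n = trans (+-identityˡ _) ratK-0

  Q-single : ∀ {x} → Primitive x → ∀ m → 1 ℕ.≤ m → m ℕ.< proj₁ x → Q (x ∷ []) (+ m) ≈ 0#
  Q-single {a , ζ} prim m 1≤m m<a = begin
    T unit ((a , ζ) ∷ []) (+ m) + ratK K (polyNeg (a ∷ []) (+ m))
      ≈⟨ +-cong (T-single a ζ m prim 1≤m m<a)
           (trans (reflexive (≡.cong (ratK K) (polyNeg-single a (+ m)))) (ratK-invℕ a (proj₁ prim))) ⟩
    - nat a ⁻¹ + nat a ⁻¹
      ≈⟨ -‿inverseˡ _ ⟩
    0# ∎

  -- Modulus 1 makes all the sums empty, so only the polynomial remains. Two entries are the least
  -- possible: for a single `trivial` the value is 1, while range (ii) is empty.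
  Q-ones : ∀ k → Q (replicate (suc (suc k)) trivial) (+ 1) ≈ 0#
  Q-ones k = trans (+-cong (T-ones (suc (suc k)) unit (+ 1))
    (trans (reflexive (≡.cong (ratK K) (≡.trans (≡.cong (λ L → polyNeg L (+ 1)) (map-replicate proj₁ (suc (suc k)) trivial)) (polyNeg-ones k)))) ratK-0))
    (+-identityʳ 0#)

  -- Vanishing strictly between 0 and the sum of the sizes

  Constant : List Entry → Set ℓ
  Constant L = ∀ i → suc i ℕ.< total L → Q L (+ suc i) ≈ Q L (+ 1)

  telescope : ∀ {L} → Valid L → ∀ c m → (∀ j → j ℕ.< m → Q L (+ suc j) ≈ c) →
    Q (trivial ∷ L) (+ 1) ≈ Q (trivial ∷ L) (+ suc m) + nat m * c
  telescope v c zero    p = sym (trans (+-congˡ (zeroˡ c)) (+-identityʳ _))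
  telescope {L} v c (suc m) p = begin
    Q (trivial ∷ L) (+ 1)
      ≈⟨ telescope v c m (λ j j<m → p j (ℕₚ.m<n⇒m<1+n j<m)) ⟩
    Q (trivial ∷ L) (+ suc m) + nat m * c
      ≈⟨ +-congʳ (Q-diff (Valid-one v) (+ suc m)) ⟩
    (Q (trivial ∷ L) (+ (suc m ℕ.+ 1)) + Q L (+ suc m)) + nat m * c
      ≈⟨ +-congʳ (+-cong (reflexive (≡.cong (λ z → Q (trivial ∷ L) (+ suc z)) (ℕₚ.+-comm m 1))) (p m ℕₚ.≤-refl)) ⟩
    (Q (trivial ∷ L) (+ suc (suc m)) + c) + nat m * c
      ≈⟨ solve 3 (λ q c n → (q :+ c) :+ n :* c := q :+ (con (+ 1) :+ n) :* c) refl _ c (nat m) ⟩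
    Q (trivial ∷ L) (+ suc (suc m)) + nat (suc m) * c ∎

  -- Telescoping in steps of 1 turns the left side into the difference of Q for 1∷a∷L between 1 and
  -- 1 + a. Read as a single step of length a, the same difference is Q for 1∷L at 1.
  replace-by-one : ∀ {a ζ L} → Valid ((a , ζ) ∷ L) → 1 ℕ.≤ total L → Constant ((a , ζ) ∷ L) →
    nat a * Q ((a , ζ) ∷ L) (+ 1) ≈ Q (trivial ∷ L) (+ 1)
  replace-by-one {a} {ζ} {L} v 1≤L const = begin
    nat a * r
      ≈⟨ solve 2 (λ q z → z := (q :+ z) :- q) refl q (nat a * r) ⟩
    (q + nat a * r) - q
      -- The arguments 1, ..., a all lie in the interval of constancy because `total L` is at least
      -- 1.
      ≈⟨ +-congʳ (telescope v r a (λ j j<a → const j (ℕₚ.<-≤-trans (ℕ.s≤s j<a)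
           (ℕₚ.≤-trans (ℕₚ.≤-reflexive (ℕₚ.+-comm 1 a)) (ℕₚ.+-monoʳ-≤ a 1≤L))))) ⟨
    Q (trivial ∷ x ∷ L) (+ 1) - q
      ≈⟨ +-congʳ (trans (Q-↭ swapped (+ 1)) (Q-diff (Valid-↭ swapped (Valid-one v)) (+ 1))) ⟩
    (Q (x ∷ trivial ∷ L) (+ suc a) + Q (trivial ∷ L) (+ 1)) - q
      ≈⟨ +-congʳ (+-congʳ (Q-↭ swapped (+ suc a))) ⟨
    (q + Q (trivial ∷ L) (+ 1)) - q
      ≈⟨ solve 2 (λ q z → (q :+ z) :- q := z) refl q _ ⟩
    Q (trivial ∷ L) (+ 1) ∎
    where
    x = a , ζ
    r = Q (x ∷ L) (+ 1)
    q = Q (trivial ∷ x ∷ L) (+ suc a)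
    swapped : trivial ∷ x ∷ L ↭ x ∷ trivial ∷ L
    swapped = swap trivial x Perm.refl

  total-positive : ∀ {L} → All Primitive L → 1 ℕ.≤ length L → 1 ℕ.≤ total L
  total-positive ((1≤a , _) ∷ _) _ = ℕₚ.≤-trans 1≤a (ℕₚ.m≤m+n _ _)

  -- Entries of L are exchanged for ones at the cost of a factor a, which is cancelled in
  -- characteristic zero. The block of ones grows as L shrinks, so the length stays the one for
  -- which constancy is assumed.
  zero-at-1 : ∀ e → (∀ L → length L ≡ suc (suc e) → Valid L → Constant L) →
    ∀ L k → length (replicate k trivial ++ L) ≡ suc (suc e) → Valid (replicate k trivial ++ L) → Q (replicate k trivial ++ L) (+ 1) ≈ 0#
  zero-at-1 e const [] k len v = trans
    (reflexive (≡.cong (λ M → Q M (+ 1)) (≡.trans (++-identityʳ (replicate k trivial)) (≡.cong (λ d → replicate d trivial) k≡))))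
    (Q-ones e)
    where k≡ = ≡.trans (≡.sym (≡.trans (≡.cong length (++-identityʳ (replicate k trivial))) (length-replicate k))) len
  zero-at-1 e const ((a , ζ) ∷ L) k len v = trans (Q-↭ p (+ 1)) (*-cancelʳ (nat≉0 a (proj₁ (All.head (proj₁ v′)))) (begin
    Q (x ∷ R) (+ 1) * nat a     ≈⟨ *-comm _ _ ⟩
    nat a * Q (x ∷ R) (+ 1)     ≈⟨ replace-by-one v′ (total-positive (proj₁ (Valid-tail v′)) (ℕₚ.≤-pred (≡.subst (2 ℕ.≤_) (≡.sym len′) (ℕ.s≤s (ℕ.s≤s ℕ.z≤n))))) (const (x ∷ R) len′ v′) ⟩
    Q (trivial ∷ R) (+ 1)          ≈⟨ zero-at-1 e const L (suc k) len′ (Valid-one (Valid-tail v′)) ⟩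
    0#                          ≈⟨ zeroˡ _ ⟨
    0# * nat a                  ∎))
    where
    x = a , ζ
    R = replicate k trivial ++ L
    p : replicate k trivial ++ x ∷ L ↭ x ∷ R
    p = Permₚ.shift x (replicate k trivial) L
    v′ = Valid-↭ p v
    len′ : length (x ∷ R) ≡ suc (suc e)
    len′ = ≡.trans (≡.sym (Permₚ.↭-length p)) len

  -- Without a, the list has vanishing Q strictly between 0 and b + `total M`, which is precisely
  -- where Fine-Wilf asks for the period a; likewise for b after a swap.
  constant : ∀ e → (∀ L → length L ≡ suc e → Valid L → ∀ i → suc i ℕ.< total L → Q L (+ suc i) ≈ 0#) →
    ∀ L → length L ≡ suc (suc e) → Valid L → Constant L
  constant e vanish ((a , ζ) ∷ (b , η) ∷ M) len v@((1≤a , _) ∷ (1≤b , _) ∷ _ , (cop ∷ _) ∷ _) i i< =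
    -- Position i stands for the argument i + 1, and the surplus length of the window is `total M`.
    FineWilf.constant setoid (λ i → Q L (+ suc i)) (total M) a b 1≤a 1≤b cop period-a period-b i
      (≡.subst (suc i ℕ.<_) (≡.sym (ℕₚ.+-assoc a b (total M))) i<)
    where
    L  = (a , ζ) ∷ (b , η) ∷ M
    p : L ↭ (b , η) ∷ (a , ζ) ∷ M
    p = swap (a , ζ) (b , η) Perm.refl
    v′ = Valid-↭ p v
    period-a : ∀ i → suc i ℕ.< b ℕ.+ total M → Q L (+ suc i) ≈ Q L (+ suc (i ℕ.+ a))
    period-a i i< = trans (Q-diff v (+ suc i))
      (trans (+-congˡ (vanish ((b , η) ∷ M) (ℕₚ.suc-injective len) (Valid-tail v) i i<)) (+-identityʳ _))
    period-b : ∀ i → suc i ℕ.< a ℕ.+ total M → Q L (+ suc i) ≈ Q L (+ suc (i ℕ.+ b))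
    period-b i i< = trans (Q-↭ p (+ suc i)) (trans (Q-diff v′ (+ suc i))
      (trans (+-congˡ (vanish ((a , ζ) ∷ M) (ℕₚ.suc-injective len) (Valid-tail v′) i i<))
        (trans (+-identityʳ _) (sym (Q-↭ p (+ suc (i ℕ.+ b)))))))

  vanish-between : ∀ d L → length L ≡ suc d → Valid L → ∀ i → suc i ℕ.< total L → Q L (+ suc i) ≈ 0#
  vanish-between zero    (x ∷ []) _ (prim ∷ [] , _) i i< = Q-single prim (suc i) (ℕ.s≤s ℕ.z≤n) (ℕₚ.<-≤-trans i< (ℕₚ.≤-reflexive (ℕₚ.+-identityʳ _)))
  vanish-between (suc e) L        len v             i i< = trans (const L len v i i<) (zero-at-1 e const L 0 len v)
    where const = constant e (vanish-between e)

  vanish-between′ : ∀ L → 1 ℕ.≤ length L → Valid L → ∀ m → 1 ℕ.≤ m → m ℕ.< total L → Q L (+ m) ≈ 0#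
  vanish-between′ L@(_ ∷ M) _ v (suc i) _ = vanish-between (length M) L ≡.refl v i

  -- Vanishing just outside the interval

  -- As 0 < t < a, adding a to -t lands inside the interval, where Q is already 0; what remains is Q
  -- of the tail at the same -t, down to the empty list.
  vanish-below : ∀ L → Valid L → ∀ t → 1 ℕ.≤ t → All (λ x → t ℕ.< proj₁ x) L → Q L (ℤ.- + t) ≈ 0#
  vanish-below []            v t 1≤t _          = Q-[] (ℤ.- + t)
  vanish-below ((a , ζ) ∷ L) v t 1≤t (t<a ∷ t<L) = begin
    Q ((a , ζ) ∷ L) (ℤ.- + t)
      ≈⟨ Q-diff v (ℤ.- + t) ⟩
    Q ((a , ζ) ∷ L) (ℤ.- + t ℤ.+ + a) + Q L (ℤ.- + t)
      ≈⟨ +-cong (trans (reflexive (≡.cong (Q ((a , ζ) ∷ L)) a∸t))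
           (vanish-between′ ((a , ζ) ∷ L) (ℕ.s≤s ℕ.z≤n) v (a ∸ t) (ℕₚ.m<n⇒0<n∸m t<a)
             (ℕₚ.<-≤-trans (ℕₚ.∸-monoʳ-< 1≤t (ℕₚ.<⇒≤ t<a)) (ℕₚ.m≤m+n a (total L)))))
           (vanish-below L (Valid-tail v) t 1≤t t<L) ⟩
    0# + 0#
      ≈⟨ +-identityʳ 0# ⟩
    0# ∎
    where
    a∸t : ℤ.- + t ℤ.+ + a ≡ + (a ∸ t)
    a∸t = ≡.trans (ℤₚ.-m+n≡n⊖m t a) (ℤₚ.⊖-≥ (ℕₚ.<⇒≤ t<a))

  -- The difference equation is read backwards from `total L` + t, which lies inside the interval of
  -- the longer list because t < a.
  vanish-above : ∀ L → Valid L → ∀ t → 1 ℕ.≤ t → All (λ x → t ℕ.< proj₁ x) L → Q L (+ (total L ℕ.+ t)) ≈ 0#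
  vanish-above []            v t 1≤t _          = Q-[] (+ t)
  vanish-above ((a , ζ) ∷ L) v t 1≤t (t<a ∷ t<L) = begin
    Q (x ∷ L) (+ (a ℕ.+ total L ℕ.+ t))
      ≡⟨ ≡.cong (λ z → Q (x ∷ L) (+ z)) (≡.trans (ℕₚ.+-assoc a (total L) t) (ℕₚ.+-comm a m)) ⟩
    Q (x ∷ L) (+ m ℤ.+ + a)
      ≈⟨ trans (+-congˡ (vanish-above L (Valid-tail v) t 1≤t t<L)) (+-identityʳ _) ⟨
    Q (x ∷ L) (+ m ℤ.+ + a) + Q L (+ m)
      ≈⟨ Q-diff v (+ m) ⟨
    Q (x ∷ L) (+ m)
      ≈⟨ vanish-between′ (x ∷ L) (ℕ.s≤s ℕ.z≤n) v m (ℕₚ.≤-trans 1≤t (ℕₚ.m≤n+m t (total L)))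
           (≡.subst (ℕ._< a ℕ.+ total L) (ℕₚ.+-comm t (total L)) (ℕₚ.+-monoˡ-< (total L) t<a)) ⟩
    0# ∎
    where
    x = a , ζ
    m = total L ℕ.+ t

  -- Passage to the sums and ranges of the statement

  sumFin-cong : ∀ k {f g : Fin k → Carrier} → (∀ i → f i ≈ g i) → sumFin K k f ≈ sumFin K k g
  sumFin-cong zero    p = refl
  sumFin-cong (suc k) p = +-cong (p zero) (sumFin-cong k (λ i → p (suc i)))

  -- The inverse of 0 is unspecified, so the product must be shown nonzero along with the formula
  -- for its inverse.
  prodFin-⁻¹ : ∀ k (f : Fin k → Carrier) → (∀ i → ¬ f i ≈ 0#) →
    ¬ prodFin K k f ≈ 0# × prodFin K k f ⁻¹ ≈ prodFin K k (λ i → f i ⁻¹)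
  prodFin-⁻¹ zero    f f≉0 = 1≉0 , sym (⁻¹-unique (*-identityʳ 1#))
  prodFin-⁻¹ (suc k) f f≉0 with prodFin-⁻¹ k (λ i → f (suc i)) (λ i → f≉0 (suc i))
  ... | tail≉0 , tail⁻¹ = *-≉0 (f≉0 zero) tail≉0 , trans (⁻¹-* (f≉0 zero) tail≉0) (*-congˡ tail⁻¹)

  prodFin≈facs : ∀ k (a : Fin k → ℕ) ζ j → prodFin K k (λ i → fac (a i) ζ j) ≈ facs (tabulate a) ζ j
  prodFin≈facs zero    a ζ j = refl
  prodFin≈facs (suc k) a ζ j = *-congˡ (prodFin≈facs k (λ i → a (suc i)) ζ j)

  entries : ∀ {d} → (Fin d → ℕ) → (Fin d → Carrier) → List Entry
  entries a ζ = tabulate (λ i → a i , ζ i)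

  sizes-entries : ∀ {d} (a : Fin d → ℕ) (ζ : Fin d → Carrier) → sizes (entries a ζ) ≡ tabulate a
  sizes-entries a ζ = map-tabulate (λ i → a i , ζ i) proj₁

  weighted-S : Weight → (e : ℕ) → (Fin (suc e) → ℕ) → (Fin (suc e) → Carrier) → ℤ → Fin (suc e) → Carrier
  weighted-S g e a ζ n m = nat (a m) ⁻¹ * sumTo (λ j → zpow K (ζ m) (+ j ℤ.* n) *
    (g (ζ m) j * prodFin K e (λ i → fac (removeAt a m i) (ζ m) j))) (a m ∸ 1)

  sum-weighted-S : ∀ g e a ζ n → sumFin K (suc e) (weighted-S g e a ζ n) ≈ T g (entries a ζ) n
  sum-weighted-S g zero    a ζ n = refl
  sum-weighted-S g (suc e) a ζ n = +-cong
    (*-congˡ (sumTo-cong (a zero ∸ 1) (λ j _ _ → *-congˡ (*-congˡ (trans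
      (prodFin≈facs (suc e) (λ i → a (suc i)) (ζ zero) j)
      (reflexive (≡.cong (λ cs → facs cs (ζ zero) j) (≡.sym (sizes-entries (λ i → a (suc i)) (λ i → ζ (suc i)))))))))))
    (trans (sumFin-cong (suc e) reweight) (sum-weighted-S (g ⊙ fac (a zero)) e (λ i → a (suc i)) (λ i → ζ (suc i)) n))
    where
    -- `removeAt` at a successor index keeps the head, whose factor is moved into the weight.
    reweight : ∀ m → weighted-S g (suc e) a ζ n (suc m)
      ≈ weighted-S (g ⊙ fac (a zero)) e (λ i → a (suc i)) (λ i → ζ (suc i)) n m
    reweight m = *-congˡ (sumTo-cong (a (suc m) ∸ 1) (λ j _ _ → *-congˡ (sym (*-assoc (g (ζ (suc m)) j)
      (fac (a zero) (ζ (suc m)) j) (prodFin K e (λ i → fac (removeAt (λ i → a (suc i)) m i) (ζ (suc m)) j))))))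

  -- Coprimality keeps every factor 1 - ζ^(j c) nonzero, as is needed to distribute the inverse over
  -- the product.
  S≈weighted-S : ∀ e a ζ n → (∀ i → Primitive (a i , ζ i)) → (∀ i j → i ≢ j → Coprime (a i) (a j)) →
    ∀ m → S K e (removeAt a m) (a m) (ζ m) n ≈ weighted-S unit e a ζ n m
  S≈weighted-S e a ζ n prim cop m = *-congˡ (trans (reflexive (sumFrom1≡sumTo (a m) _))
    (sumTo-cong (a m ∸ 1) (λ j 1≤j j≤ → *-congˡ (trans
      (proj₂ (prodFin-⁻¹ e (λ i → 1# - ζ m ^ (j ℕ.* removeAt a m i)) (λ i → 1-≉0 (separated i j 1≤j j≤))))
      (sym (*-identityˡ _))))))
    where
    separated : ∀ i → Separated (removeAt a m i) (a m , ζ m)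
    separated i = coprime⇒separated (cop (punchIn m i) m (Finₚ.punchInᵢ≢i m i)) (prim m)

  sum-tabulate : ∀ d (a : Fin d → ℕ) → sum (tabulate a) ≡ sumℕ d a
  sum-tabulate zero    a = ≡.refl
  sum-tabulate (suc d) a = ≡.cong (a zero ℕ.+_) (sum-tabulate d (λ i → a (suc i)))

  minℕ-≤ : ∀ e (a : Fin (suc e) → ℕ) i → minℕ e a ℕ.≤ a i
  minℕ-≤ zero    a zero    = ℕₚ.≤-refl
  minℕ-≤ (suc e) a zero    = ℕₚ.m⊓n≤m _ _
  minℕ-≤ (suc e) a (suc i) = ℕₚ.≤-trans (ℕₚ.m⊓n≤n (a zero) _) (minℕ-≤ e (λ i → a (suc i)) i)

  Range : ℕ → ℕ → ℤ → Set
  Range min tot n =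
    (((+ 1) ℤ.- (+ min) ℤ.≤ n) × (n ℤ.≤ ℤ.- (+ 1)))
    ⊎ (((+ 1) ℤ.≤ n) × (n ℤ.≤ (+ tot) ℤ.- (+ 1)))
    ⊎ (((+ tot) ℤ.+ (+ 1) ℤ.≤ n) × (n ℤ.≤ (+ tot) ℤ.+ (+ min) ℤ.- (+ 1)))

  -- The three ranges through natural offsets, free of integer subtraction, as the inductions on
  -- lists use them.
  data Position (min tot : ℕ) : ℤ → Set where
    below   : ∀ t → 1 ℕ.≤ t → t ℕ.< min → Position min tot (ℤ.- + t)
    between : ∀ m → 1 ℕ.≤ m → m ℕ.< tot → Position min tot (+ m)
    above   : ∀ t → 1 ℕ.≤ t → t ℕ.< min → Position min tot (+ (tot ℕ.+ t))

  i≤j-1⇒i<j : ∀ {i j} → i ℤ.≤ j ℤ.- + 1 → i ℤ.< j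
  i≤j-1⇒i<j {i} {j} p = ℤₚ.i≤pred[j]⇒i<j (≡.subst (i ℤ.≤_) (ℤₚ.+-comm j -[1+ 0 ]) p)

  position : ∀ min tot n → Range min tot n → Position min tot n
  -- The bound `(+ 1) ℤ.- (+ min)` is by definition the integer successor of -min.
  position min tot -[1+ s ] (inj₁ (lower , _)) = below (suc s) (ℕ.s≤s ℕ.z≤n)
    (ℤₚ.drop‿+<+ (ℤₚ.neg-cancel-< (ℤₚ.suc[i]≤j⇒i<j lower)))
  position min tot (+ m) (inj₁ (_ , ()))
  position min tot -[1+ s ] (inj₂ (inj₁ (() , _)))
  position min tot -[1+ s ] (inj₂ (inj₂ (() , _)))
  position min tot (+ m) (inj₂ (inj₁ (lower , upper))) = between m (ℤₚ.drop‿+≤+ lower) (ℤₚ.drop‿+<+ (i≤j-1⇒i<j upper))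
  position min tot (+ k) (inj₂ (inj₂ (lower , upper))) =
    ≡.subst (λ z → Position min tot (+ z)) k≡ (above (k ∸ tot) 1≤t t<min)
    where
    tot<k : tot ℕ.< k
    tot<k = ℕₚ.≤-trans (ℕₚ.≤-reflexive (ℕₚ.+-comm 1 tot)) (ℤₚ.drop‿+≤+ lower)
    k≡ : tot ℕ.+ (k ∸ tot) ≡ k
    k≡ = ℕₚ.m+[n∸m]≡n (ℕₚ.<⇒≤ tot<k)
    1≤t : 1 ℕ.≤ k ∸ tot
    1≤t = ℕₚ.m<n⇒0<n∸m tot<k
    t<min : k ∸ tot ℕ.< min
    t<min = ℕₚ.+-cancelˡ-< tot _ _ (≡.subst (ℕ._< tot ℕ.+ min) (≡.sym k≡) (ℤₚ.drop‿+<+ (i≤j-1⇒i<j upper)))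

  Q≈0 : ∀ min L → 1 ℕ.≤ length L → Valid L → All (λ x → min ℕ.≤ proj₁ x) L → ∀ {n} → Position min (total L) n → Q L n ≈ 0#
  Q≈0 min L 1≤L v min≤ (below t 1≤t t<min)   = vanish-below L v t 1≤t (All.map (ℕₚ.<-≤-trans t<min) min≤)
  Q≈0 min L 1≤L v min≤ (between m 1≤m m<tot) = vanish-between′ L 1≤L v m 1≤m m<tot
  Q≈0 min L 1≤L v min≤ (above t 1≤t t<min)   = vanish-above L v t 1≤t (All.map (ℕₚ.<-≤-trans t<min) min≤)

  sum-S≈-poly : ∀ e (a : Fin (suc e) → ℕ) n → (∀ i → 1 ℕ.≤ a i) → (∀ i j → i ≢ j → Coprime (a i) (a j)) →
    Range (minℕ e a) (sumℕ (suc e) a) n → (ζ : Fin (suc e) → Carrier) → (∀ i → IsPrimitiveRoot K (a i) (ζ i)) →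
    sumFin K (suc e) (λ m → S K e (removeAt a m) (a m) (ζ m) n) ≈ ratK K (ℚ.- poly (suc e) a (ℚ.- (n ℚ./ 1)))
  sum-S≈-poly e a n 1≤a cop range ζ root = begin
    sumFin K (suc e) (λ m → S K e (removeAt a m) (a m) (ζ m) n)
      ≈⟨ trans (sumFin-cong (suc e) (S≈weighted-S e a ζ n prim cop)) (sum-weighted-S unit e a ζ n) ⟩
    T unit L n
      ≈⟨ solve 2 (λ t r → t := (t :+ r) :- r) refl _ (ratK K (polyNeg (sizes L) n)) ⟩
    Q L n - ratK K (polyNeg (sizes L) n)
      ≈⟨ trans (+-congʳ (Q≈0 (minℕ e a) L (ℕ.s≤s ℕ.z≤n) valid (Allₚ.tabulate⁺ {f = λ i → a i , ζ i} (minℕ-≤ e a))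
           (≡.subst (λ z → Position (minℕ e a) z n) (≡.sym total≡) (position _ _ n range)))) (+-identityˡ _) ⟩
    - ratK K (polyNeg (sizes L) n)
      ≈⟨ ratK-neg (polyNeg (sizes L) n) ⟨
    ratK K (ℚ.- polyNeg (sizes L) n)
      ≡⟨ ≡.cong (λ q → ratK K (ℚ.- q)) (≡.trans (≡.cong (λ as → polyNeg as n) (sizes-entries a ζ)) (≡.sym (poly≡polyNeg e a n))) ⟩
    ratK K (ℚ.- poly (suc e) a (ℚ.- (n ℚ./ 1))) ∎
    where
    L = entries a ζ
    prim : ∀ i → Primitive (a i , ζ i)
    prim i = 1≤a i , root i
    valid : Valid L
    valid = Allₚ.tabulate⁺ {f = λ i → a i , ζ i} prim , AllPairsₚ.tabulate⁺ {R = CoprimeEntries} {f = λ i → a i , ζ i} (λ {i} {j} i≢j → cop i j i≢j)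
    total≡ : total L ≡ sumℕ (suc e) a
    total≡ = ≡.trans (≡.cong sum (sizes-entries a ζ)) (sum-tabulate (suc e) a)

theorem26 : ∀ {c ℓ : Level} (e : ℕ) (a : Fin (suc e) → ℕ) (n : ℤ)
    → (∀ i → 1 ℕ.≤ a i)
    → (∀ i j → i ≢ j → Coprime (a i) (a j))
    → (((+ 1) ℤ.- (+ minℕ e a) ℤ.≤ n) × (n ℤ.≤ ℤ.- (+ 1)))
    ⊎ (((+ 1) ℤ.≤ n) × (n ℤ.≤ (+ sumℕ (suc e) a) ℤ.- (+ 1)))
    ⊎ (((+ sumℕ (suc e) a) ℤ.+ (+ 1) ℤ.≤ n)
    × (n ℤ.≤ (+ sumℕ (suc e) a) ℤ.+ (+ minℕ e a) ℤ.- (+ 1)))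
    → (K : Char0Field c ℓ) (ζ : Fin (suc e) → Char0Field.Carrier K)
    → (∀ i → IsPrimitiveRoot K (a i) (ζ i))
    → Char0Field._≈_ K
    (sumFin K (suc e) (λ m → S K e (removeAt a m) (a m) (ζ m) n))
    (ratK K (ℚ.- poly (suc e) a (ℚ.- (n / 1))))
theorem26 e a n 1≤a coprime range K ζ root = OverField.sum-S≈-poly K e a n 1≤a coprime range ζ root
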